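{- For all integers $n,m\ge1$, $$\mathrm{OPT}^{\mathrm{rand}}_n(m)=\mathrm{OPT}^{\mathrm{rand,full}}_n(m),$$ i.e. in the adversarial-order secretary problem, the optimal worst-case success probability of randomized policies with a single $\alpha$-power signal with $\alpha=m$ equals that of randomized policies that observe all $m$ independent uniform signals (both models are defined in the context).
   Context: Notation: $[n]=\{1,\dots,n\}$. Adversarial-order secretary problem: an adversary fixes an instance, i.e. a value vector $v\in\mathbb{N}_0^n$ with a unique maximum entry, located at a time $i^\star\in[n]$. Items arrive one by one at times $1,\dots,n$ in this order. At each time $t$ the policy observes $v_t$ together with the signal information described below, and then irrevocably decides whether to stop at time $t$. It knows $n$ and the signal parameter ($\alpha$ or $m$), but not the instance; it succeeds if it stops exactly at time $i^\star$. A randomized policy may use internal randomness independent of the signals. The worst-case success probability of a policy is the infimum over all instances of length $n$ of its success probability (over the signals and the internal randomness). Single $\alpha$-power signal model: one signal time $S\in[i^\star]$ is drawn with $\Pr[S=s]=\frac{s^\alpha-(s-1)^\alpha}{(i^\star)^\alpha}$ for $s\in[i^\star]$, and at time $t$ the policy observes whether $S=t$. $\mathrm{OPT}^{\mathrm{rand}}_n(\alpha)$ is the supremum of the worst-case success probability over all randomized policies in this model. (For $\alpha=m$ a positive integer, $S$ has the law of the maximum of $m$ independent uniform variables on $[i^\star]$.) Full-history model with $m$ signals: signal times $S_1,\dots,S_m$ are drawn independently and uniformly from $[i^\star]$, and at each time $t$ the policy observes the number of signals occurring at time $t$. $\mathrm{OPT}^{\mathrm{rand,full}}_n(m)$ is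 the supremum of the worst-case success probability over all randomized policies in this model. -}

module Defs where

open import Data.Bool.Base using (Bool; true; false; T; not; _∧_)
open import Data.Fin.Base using (Fin; zero; suc; toℕ; inject≤)
open import Data.Fin.Properties using (toℕ<n)
open import Data.Integer.Base using (+_)
open import Data.List.Base as List using (List; []; _∷_; allFin; foldr; concatMap)
open import Data.Nat.Base as ℕ using (ℕ; zero; suc)
import Data.Nat.Properties as ℕ
open import Data.Product.Base using (∃-syntax; _×_; _,_; proj₂)
open import Data.Rational.Base as ℚ
  using (ℚ; 0ℚ; 1ℚ; ½; _+_; _*_; _-_; 1/_; ∣_∣; _≤_; _<_; _/_)
import Data.Rational.Properties as ℚ
open import Data.Rational.Solver using (module +-*-Solver)
open import Data.Vec.Base using (Vec; []; _∷_; tabulate; lookup; count)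
open import Function.Base using (_∘_; const)
open import Function.Bundles using (_⇔_; mk⇔)
open import Level using (Level; _⊔_; 0ℓ) renaming (suc to lsuc)
open import Relation.Binary.PropositionalEquality
open import Relation.Nullary using (¬_; does)

IsCauchy : (ℕ → ℚ) → Set
IsCauchy x = ∀ ε → 0ℚ < ε → ∃[ N ] (∀ j k → N ℕ.≤ j → N ℕ.≤ k → ∣ x j - x k ∣ ≤ ε)

record ℝ : Set where
  constructor mkℝ
  field
    seq    : ℕ → ℚ
    cauchy : IsCauchy seq

open ℝ public

infix  4 _≈ᵣ_ _≤ᵣ_ _⟶_
infixl 6 _+ᵣ_
infixr 7 _·ᵣ_

_≈ᵣ_ : ℝ → ℝ → Set
x ≈ᵣ y = ∀ ε → 0ℚ < ε → ∃[ N ] (∀ k → N ℕ.≤ k → ∣ seq x k - seq y k ∣ ≤ ε)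

_≤ᵣ_ : ℝ → ℝ → Set
x ≤ᵣ y = ∀ ε → 0ℚ < ε → ∃[ N ] (∀ k → N ℕ.≤ k → seq x k ≤ seq y k + ε)

fromℚ : ℚ → ℝ
fromℚ q = mkℝ (const q) λ ε 0<ε →
  0 , λ _ _ _ _ → subst (λ z → ∣ z ∣ ≤ ε) (sym (ℚ.+-inverseʳ q)) (ℚ.<⇒≤ 0<ε)

private
  halves : ∀ ε → ½ * ε + ½ * ε ≡ ε
  halves ε = trans (sym (ℚ.*-distribʳ-+ ε ½ ½)) (ℚ.*-identityˡ ε)

  0<½ε : ∀ ε → 0ℚ < ε → 0ℚ < ½ * ε
  0<½ε ε 0<ε = subst (_< ½ * ε) (ℚ.*-zeroʳ ½) (ℚ.*-monoʳ-<-pos ½ 0<ε)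

  interchange : ∀ a b c d → (a + b) - (c + d) ≡ (a - c) + (b - d)
  interchange = solve 4
    (λ a b c d → ((a :+ b) :- (c :+ d)) := ((a :- c) :+ (b :- d))) refl
    where open +-*-Solver

_+ᵣ_ : ℝ → ℝ → ℝ
x +ᵣ y = mkℝ (λ k → seq x k + seq y k) λ ε 0<ε →
  let N , p = cauchy x (½ * ε) (0<½ε ε 0<ε)
      M , q = cauchy y (½ * ε) (0<½ε ε 0<ε)
  in N ℕ.⊔ M , λ j k j≥ k≥ → begin
    ∣ (seq x j + seq y j) - (seq x k + seq y k) ∣
      ≡⟨ cong ∣_∣ (interchange (seq x j) (seq y j) (seq x k) (seq y k)) ⟩
    ∣ (seq x j - seq x k) + (seq y j - seq y k) ∣
      ≤⟨ ℚ.∣p+q∣≤∣p∣+∣q∣ (seq x j - seq x k) (seq y j - seq y k) ⟩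
    ∣ seq x j - seq x k ∣ + ∣ seq y j - seq y k ∣
      ≤⟨ ℚ.+-mono-≤ (p j k (ℕ.m⊔n≤o⇒m≤o N M j≥) (ℕ.m⊔n≤o⇒m≤o N M k≥))
                    (q j k (ℕ.m⊔n≤o⇒n≤o N M j≥) (ℕ.m⊔n≤o⇒n≤o N M k≥)) ⟩
    ½ * ε + ½ * ε
      ≡⟨ halves ε ⟩
    ε ∎
  where open ℚ.≤-Reasoning

_·ᵣ_ : ℚ → ℝ → ℝ
q ·ᵣ x = mkℝ (λ k → q * seq x k) cauchy′
  where
  open ℚ.≤-Reasoning

  M : ℚ
  M = ∣ q ∣ + 1ℚ

  0<1 : 0ℚ < 1ℚ
  0<1 = ℚ.positive⁻¹ 1ℚ

  0<M : 0ℚ < M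
  0<M = ℚ.+-mono-≤-< (ℚ.0≤∣p∣ q) 0<1

  instance
    M-pos : ℚ.Positive M
    M-pos = ℚ.positive 0<M
    M-nonZero : ℚ.NonZero M
    M-nonZero = ℚ.pos⇒nonZero M
    1/M-pos : ℚ.Positive (1/ M)
    1/M-pos = ℚ.1/pos⇒pos M

  ∣q∣≤M : ∣ q ∣ ≤ M
  ∣q∣≤M = subst (_≤ M) (ℚ.+-identityʳ ∣ q ∣) (ℚ.+-monoʳ-≤ ∣ q ∣ (ℚ.<⇒≤ 0<1))

  factor : ∀ a b → q * a - q * b ≡ q * (a - b)
  factor = solve 3 (λ q a b → (q :* a :- q :* b) := (q :* (a :- b))) refl q
    where open +-*-Solver

  cauchy′ : IsCauchy (λ k → q * seq x k)
  cauchy′ ε 0<ε =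
    let δ = 1/ M * ε
        0<δ = subst (_< δ) (ℚ.*-zeroʳ (1/ M)) (ℚ.*-monoʳ-<-pos (1/ M) 0<ε)
        N , p = cauchy x δ 0<δ
    in N , λ j k j≥ k≥ →
      let d = seq x j - seq x k in begin
      ∣ q * seq x j - q * seq x k ∣  ≡⟨ cong ∣_∣ (factor (seq x j) (seq x k)) ⟩
      ∣ q * d ∣                      ≡⟨ ℚ.∣p*q∣≡∣p∣*∣q∣ q d ⟩
      ∣ q ∣ * ∣ d ∣                  ≤⟨ ℚ.*-monoʳ-≤-nonNeg ∣ d ∣ {{ℚ.∣-∣-nonNeg d}} ∣q∣≤M ⟩
      M * ∣ d ∣                      ≤⟨ ℚ.*-monoˡ-≤-nonNeg M {{ℚ.pos⇒nonNeg M}} (p j k j≥ k≥) ⟩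
      M * (1/ M * ε)                 ≡⟨ ℚ.*-assoc M (1/ M) ε ⟨
      M * 1/ M * ε                   ≡⟨ cong (_* ε) (ℚ.*-inverseʳ M) ⟩
      1ℚ * ε                         ≡⟨ ℚ.*-identityˡ ε ⟩
      ε                              ∎

partialSum : (ℕ → ℝ) → ℕ → ℝ
partialSum x zero    = fromℚ 0ℚ
partialSum x (suc N) = partialSum x N +ᵣ x N

_⟶_ : (ℕ → ℝ) → ℝ → Set
x ⟶ L = ∀ ε → 0ℚ < ε →
  ∃[ N ] (∀ k → N ℕ.≤ k → (x k ≤ᵣ L +ᵣ fromℚ ε) × (L ≤ᵣ x k +ᵣ fromℚ ε))

-- Arbitrary suprema and infima of reals do not exist constructively as Cauchy
-- reals. They are represented by their open lower cuts: X q means "q < X".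
-- Classically, a cut that is neither empty nor everything is a real number, and
-- _≋_ is equality of reals.

Cut : (ℓ : Level) → Set (lsuc ℓ)
Cut ℓ = ℚ → Set ℓ

infix 4 _≋_

_≋_ : ∀ {a b} → Cut a → Cut b → Set (a ⊔ b)
X ≋ Y = ∀ q → X q ⇔ Y q

cut : ℝ → Cut 0ℓ
cut x q = ∃[ r ] (q < r × fromℚ r ≤ᵣ x)

sup : ∀ {i ℓ} {I : Set i} → (I → Cut ℓ) → Cut (i ⊔ ℓ)
sup X q = ∃[ i ] X i q

-- The rational r strictly above q is what makes this cut open.
inf : ∀ {i ℓ} {I : Set i} → (I → Cut ℓ) → Cut (i ⊔ ℓ)
inf X q = ∃[ r ] (q < r × (∀ i → X i r))

IsUnion : {Ω : Set} → (Ω → Bool) → (ℕ → Ω → Bool) → Set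
IsUnion F E = ∀ ω → T (F ω) ⇔ (∃[ k ] T (E k ω))

PairwiseDisjoint : {Ω : Set} → (ℕ → Ω → Bool) → Set
PairwiseDisjoint E = ∀ {j k} → j ≢ k → ∀ ω → T (E j ω) → ¬ T (E k ω)

-- Events are decidable subsets. Under excluded middle these are all subsets,
-- every countable union is one of them, and the axioms below are the usual
-- ones for a countably additive probability measure on a σ-algebra.
-- Constructively, closure under unions is demanded only for decidable unions,
-- since otherwise even a fair coin would not be an instance.
record ProbabilitySpace : Set₁ where
  field
    Ω          : Set
    Measurable : (Ω → Bool) → Set
    full       : Measurable (const true)
    complement : ∀ {E} → Measurable E → Measurable (not ∘ E)
    union      : ∀ {E F} → (∀ k → Measurable (E k)) → IsUnion F E → Measurable F
    ℙ          : (E : Ω → Bool) → Measurable E → ℝ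
    ℙ-cong     : ∀ {E F} (e : Measurable E) (f : Measurable F) →
                 E ≗ F → ℙ E e ≈ᵣ ℙ F f
    ℙ-nonNeg   : ∀ {E} (e : Measurable E) → fromℚ 0ℚ ≤ᵣ ℙ E e
    ℙ-full     : ℙ (const true) full ≈ᵣ fromℚ 1ℚ
    ℙ-additive : ∀ {E F} (e : ∀ k → Measurable (E k)) (f : Measurable F) →
                 PairwiseDisjoint E → IsUnion F E →
                 partialSum (λ k → ℙ (E k) (e k)) ⟶ ℙ F f

record Instance (n : ℕ) : Set where
  field
    value  : Vec ℕ n
    i⋆     : Fin n
    unique : ∀ j → j ≢ i⋆ → lookup value j ℕ.< lookup value i⋆

-- Times 1, …, n are the elements of Fin n in order; a history up to time t
-- consists of the values and signal observations at all times up to and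
-- including t.

History : Set → {n : ℕ} → Fin n → Set
History O t = Vec (ℕ × O) (suc (toℕ t))

history : ∀ {O n} → Vec ℕ n → (Fin n → O) → (t : Fin n) → History O t
history v obs t = tabulate λ j → let s = inject≤ j (toℕ<n t) in lookup v s , obs s

record Policy (O : Set) (n : ℕ) : Set₁ where
  field
    space : ProbabilitySpace
  open ProbabilitySpace space public
  field
    stop?            : Ω → (t : Fin n) → History O t → Bool
    stop?-measurable : ∀ t h → Measurable (λ ω → stop? ω t h)

firstAt : ∀ {n} → (Fin n → Bool) → Fin n → Bool
firstAt d zero    = d zero
firstAt d (suc i) = not (d zero) ∧ firstAt (d ∘ suc) i

module _ (S : ProbabilitySpace) where
  open ProbabilitySpace S

  ∧-measurable : ∀ {E F} → Measurable E → Measurable F →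
                 Measurable (λ ω → E ω ∧ F ω)
  ∧-measurable {E} {F} e f = union {E = λ _ ω → E ω ∧ F ω} (const m) λ ω →
      mk⇔ (0 ,_) proj₂
    where
    G : ℕ → Ω → Bool
    G zero    ω = not (E ω)
    G (suc _) ω = not (F ω)

    G-measurable : ∀ k → Measurable (G k)
    G-measurable zero    = complement e
    G-measurable (suc _) = complement f

    ¬∧ : ∀ a b (g : ℕ → Bool) → g 0 ≡ not a → (∀ k → g (suc k) ≡ not b) →
         T (not (a ∧ b)) ⇔ (∃[ k ] T (g k))
    ¬∧ false b g p q = mk⇔ (λ _ → 0 , subst T (sym p) _) _
    ¬∧ true false g p q = mk⇔ (λ _ → 1 , subst T (sym (q 0)) _) _
    ¬∧ true true g p q = mk⇔ (λ ()) λ where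
      (zero  , x) → subst T p x
      (suc k , x) → subst T (q k) x

    not-∧ : Measurable (λ ω → not (E ω ∧ F ω))
    not-∧ = union G-measurable λ ω → ¬∧ (E ω) (F ω) (λ k → G k ω) refl (λ _ → refl)

    notnot : ∀ b → T b ⇔ (∃[ k ] T (const {B = ℕ} (not (not b)) k))
    notnot false = mk⇔ (λ ()) λ ()
    notnot true  = mk⇔ (λ _ → 0 , _) _

    m : Measurable (λ ω → E ω ∧ F ω)
    m = union {E = λ _ ω → not (not (E ω ∧ F ω))} (λ _ → complement not-∧)
          (λ ω → notnot (E ω ∧ F ω))

  firstAt-measurable : ∀ {n} (d : Ω → Fin n → Bool) →
                       (∀ t → Measurable (λ ω → d ω t)) →
                       ∀ i → Measurable (λ ω → firstAt (d ω) i)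
  firstAt-measurable d m zero    = m zero
  firstAt-measurable d m (suc i) =
    ∧-measurable (complement (m zero))
                 (firstAt-measurable (λ ω → d ω ∘ suc) (m ∘ suc) i)

-- Success probability over the internal randomness when the instance and the
-- observed signals are fixed.
conditionalSuccess : ∀ {O n} → Policy O n → Instance n → (Fin n → O) → ℝ
conditionalSuccess π I obs =
  ℙ (λ ω → firstAt (λ t → stop? ω t (history value obs t)) i⋆)
    (firstAt-measurable space (λ ω t → stop? ω t (history value obs t))
       (λ t → stop?-measurable t (history value obs t)) i⋆)
  where open Policy π; open Instance I

-- A finite distribution, as a list of outcomes with their probabilities.
Dist : Set → Set
Dist A = List (ℚ × A)

𝔼 : ∀ {A} → Dist A → (A → ℝ) → ℝ
𝔼 D f = foldr (λ (p , a) r → p ·ᵣ f a +ᵣ r) (fromℚ 0ℚ) D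

mapᴰ : ∀ {A B : Set} → (A → B) → Dist A → Dist B
mapᴰ f = List.map λ (p , a) → p , f a

iid : ∀ {A} → Dist A → (m : ℕ) → Dist (Vec A m)
iid D zero    = (1ℚ , []) ∷ []
iid D (suc m) =
  concatMap (λ (p , a) → List.map (λ (q , as) → p * q , a ∷ as) (iid D m)) D

uniform : (k : ℕ) .{{_ : ℕ.NonZero k}} → Dist (Fin k)
uniform k = List.map (λ s → + 1 / k , s) (allFin k)

-- The time s ∈ [k] is represented by its predecessor in Fin k.
power : (α k : ℕ) .{{_ : ℕ.NonZero k}} → Dist (Fin k)
power α k = List.map (λ s → weight (toℕ s) , s) (allFin k)
  where
  weight : ℕ → ℚ
  weight s = _/_ (+ (suc s ℕ.^ α ℕ.∸ s ℕ.^ α)) (k ℕ.^ α) {{ℕ.m^n≢0 k α}}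

record SignalModel (n : ℕ) : Set₁ where
  field
    Obs : Set
    law : (i⋆ : Fin n) → Dist (Fin n → Obs)

single : (α n : ℕ) → SignalModel n
single α n = record
  { Obs = Bool
  ; law = λ i⋆ → mapᴰ (λ s t → does (toℕ s ℕ.≟ toℕ t)) (power α (suc (toℕ i⋆)))
  }

fullHistory : (m n : ℕ) → SignalModel n
fullHistory m n = record
  { Obs = ℕ
  ; law = λ i⋆ → mapᴰ (λ ss t → count (λ s → toℕ s ℕ.≟ toℕ t) ss)
                      (iid (uniform (suc (toℕ i⋆))) m)
  }

module _ {n : ℕ} (M : SignalModel n) where
  open SignalModel M

  success : Policy Obs n → Instance n → ℝ
  success π I = 𝔼 (law (Instance.i⋆ I)) (conditionalSuccess π I)

  worstCase : Policy Obs n → Cut 0ℓ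
  worstCase π = inf (λ I → cut (success π I))

  optimum : Cut (lsuc 0ℓ)
  optimum = sup worstCase

OPT-rand : (n α : ℕ) → Cut (lsuc 0ℓ)
OPT-rand n α = optimum (single α n)

OPT-rand-full : (n m : ℕ) → Cut (lsuc 0ℓ)
OPT-rand-full n m = optimum (fullHistory m n)

{-# OPTIONS --safe #-}

-- Each model simulates the other exactly, so every policy of one has a
-- counterpart of the other with the same success probability on every instance.
--
-- A policy that sees all signals knows m, hence recognises the last signal when
-- the number of observed signals reaches m; its time has the m-power law.
-- Conversely, given that the last signal is at time s, the m signals are uniform
-- on the vectors in [s]^m with maximum s. This law does not involve i⋆, so a
-- policy that sees only the last signal can draw the other ones itself as soon
-- as the signal arrives. Not acting earlier costs nothing, since stopping before
-- the last signal always fails.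

module Submission where

open import Data.Bool.Base using (Bool; true; false; not; _∧_; if_then_else_)
import Data.Bool.Properties as Bool
open import Data.Fin.Base using (Fin; zero; suc; toℕ; inject≤)
open import Data.Fin.Properties using (toℕ<n; toℕ-inject≤; toℕ-injective)
open import Data.Integer.Base as ℤ using (+_)
import Data.Integer.Properties as ℤ
open import Data.List.Base as List
  using (List; []; _∷_; _++_; allFin; upTo; concatMap; length)
import Data.List.Properties as List
open import Data.List.Relation.Unary.All as All using (All; []; _∷_)
import Data.List.Relation.Unary.All.Properties as All
open import Data.Maybe.Base using (Maybe; just; nothing; maybe′)
open import Data.Nat.Base as ℕ using (ℕ; zero; suc; s≤s; z≤n; _∸_; _≤_; _<_)
import Data.Nat.Properties as ℕ
open import Data.Product.Base using (∃-syntax; _×_; _,_; proj₁; proj₂)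
open import Data.Rational.Base as ℚ
  using (ℚ; 0ℚ; 1ℚ; ½; _+_; _*_; _-_; ∣_∣; _/_)
import Data.Rational.Properties as ℚ
open import Data.Rational.Solver using (module +-*-Solver)
import Data.Rational.Unnormalised.Base as ℚᵘ
import Data.Rational.Unnormalised.Properties as ℚᵘ
open import Data.Sum.Base using (inj₁; inj₂)
open import Data.Vec.Base as Vec using (Vec; []; _∷_; lookup; tabulate; count; replicate)
import Data.Vec.Properties as Vec
open import Data.Vec.Relation.Unary.All as VecAll using ([]; _∷_)
open import Data.Vec.Relation.Unary.Any as VecAny using (here; there)
open import Function.Base using (_∘_; const; id)
open import Function.Bundles using (mk⇔)
open import Level using (0ℓ)
open import Relation.Binary.Definitions using (tri<; tri≈; tri>)
open import Relation.Binary.PropositionalEquality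
open import Relation.Nullary using (¬_; Dec; yes; no; does; contradiction)
open import Relation.Nullary.Decidable using (dec-true; dec-false)
open import Relation.Unary using (Pred; Decidable)

open import Defs

-- The internal randomness of a policy is a fixed probability space, chosen before any signal is
-- seen, while the simulated signals must follow a law that depends on the observed time s. So one
-- vector for every possible s is drawn in advance, and the policy opens only the one that belongs
-- to the time of its signal; just the marginal law of that coordinate enters the success
-- probability. The space of the given policy is arbitrary, so it has to be multiplied by this
-- finite coin, and countable additivity must be checked for the product. All expectations over
-- signals and coins are finite weighted sums: identities between laws are proved for rational
-- functions and carried over to reals approximant by approximant. With times counted from 0, the
-- vectors with maximum s are the difference of the cubes of sides s+1 and s, and its size is the
-- numerator of the power law.

private variable
  A B C O : Set
  k m n   : ℕ

-- Fractions

-- `_/_` cancels common factors and does not compute on open terms. Unnormalised fractions do, and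
-- their equality is cross-multiplication.
toℚᵘ-/ : ∀ a b .{{_ : ℕ.NonZero b}} → ℚ.toℚᵘ (+ a / b) ℚᵘ.≃ (+ a ℚᵘ./ b)
toℚᵘ-/ a (suc b) = ℚ.toℚᵘ-fromℚᵘ (ℚᵘ.mkℚᵘ (+ a) b)

/-≡ : ∀ a b c d .{{_ : ℕ.NonZero b}} .{{_ : ℕ.NonZero d}} →
      a ℕ.* d ≡ c ℕ.* b → + a / b ≡ + c / d
/-≡ a b@(suc _) c d@(suc _) eq =
  ℚ.toℚᵘ-injective (ℚᵘ.≃-trans (toℚᵘ-/ a b) (ℚᵘ.≃-trans (ℚᵘ.*≡* cross) (ℚᵘ.≃-sym (toℚᵘ-/ c d))))
  where
  cross : + a ℤ.* + d ≡ + c ℤ.* + b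
  cross = trans (sym (ℤ.pos-* a d)) (trans (cong +_ eq) (ℤ.pos-* c b))

/-* : ∀ a b c d e f .{{_ : ℕ.NonZero b}} .{{_ : ℕ.NonZero d}} .{{_ : ℕ.NonZero f}} →
      (a ℕ.* c) ℕ.* f ≡ e ℕ.* (b ℕ.* d) → (+ a / b) * (+ c / d) ≡ + e / f
/-* a b@(suc _) c d@(suc _) e f@(suc _) eq = ℚ.toℚᵘ-injective (begin
  ℚ.toℚᵘ ((+ a / b) * (+ c / d))             ≈⟨ ℚ.toℚᵘ-homo-* (+ a / b) (+ c / d) ⟩
  ℚ.toℚᵘ (+ a / b) ℚᵘ.* ℚ.toℚᵘ (+ c / d)     ≈⟨ ℚᵘ.*-cong (toℚᵘ-/ a b) (toℚᵘ-/ c d) ⟩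
  (+ a ℚᵘ./ b) ℚᵘ.* (+ c ℚᵘ./ d)             ≈⟨ ℚᵘ.*≡* cross ⟩
  + e ℚᵘ./ f                                 ≈⟨ toℚᵘ-/ e f ⟨
  ℚ.toℚᵘ (+ e / f)                           ∎)
  where
  open ℚᵘ.≃-Reasoning
  cross : (+ a ℤ.* + c) ℤ.* + f ≡ + e ℤ.* + (b ℕ.* d)
  cross = trans (cong (ℤ._* + f) (sym (ℤ.pos-* a c)))
         (trans (sym (ℤ.pos-* (a ℕ.* c) f))
         (trans (cong +_ eq) (ℤ.pos-* e (b ℕ.* d))))

1/+/ : ∀ a b .{{_ : ℕ.NonZero b}} → (+ 1 / b) + (+ a / b) ≡ + suc a / b
1/+/ a b@(suc _) = ℚ.toℚᵘ-injective (begin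
  ℚ.toℚᵘ ((+ 1 / b) + (+ a / b))             ≈⟨ ℚ.toℚᵘ-homo-+ (+ 1 / b) (+ a / b) ⟩
  ℚ.toℚᵘ (+ 1 / b) ℚᵘ.+ ℚ.toℚᵘ (+ a / b)     ≈⟨ ℚᵘ.+-cong (toℚᵘ-/ 1 b) (toℚᵘ-/ a b) ⟩
  (+ 1 ℚᵘ./ b) ℚᵘ.+ (+ a ℚᵘ./ b)             ≈⟨ ℚᵘ.*≡* cross ⟩
  + suc a ℚᵘ./ b                             ≈⟨ toℚᵘ-/ (suc a) b ⟨
  ℚ.toℚᵘ (+ suc a / b)                       ∎)
  where
  open ℚᵘ.≃-Reasoning
  cross : (+ 1 ℤ.* + b ℤ.+ + a ℤ.* + b) ℤ.* + b ≡ + suc a ℤ.* + (b ℕ.* b)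
  cross = trans (cong (ℤ._* + b) (sym (ℤ.*-distribʳ-+ (+ b) (+ 1) (+ a))))
         (trans (ℤ.*-assoc (+ suc a) (+ b) (+ b))
                (cong (+ suc a ℤ.*_) (sym (ℤ.pos-* b b))))

0≤/ : ∀ a b .{{_ : ℕ.NonZero b}} → 0ℚ ℚ.≤ + a / b
0≤/ a b = ℚ.nonNegative⁻¹ (+ a / b) {{ℚ.normalize-nonNeg a b}}

-- Finite sums

∑ : List A → (A → ℚ) → ℚ
∑ []       f = 0ℚ
∑ (x ∷ xs) f = f x + ∑ xs f

∑-cong : ∀ {f g : A → ℚ} xs → f ≗ g → ∑ xs f ≡ ∑ xs g
∑-cong []       eq = refl
∑-cong (x ∷ xs) eq = cong₂ _+_ (eq x) (∑-cong xs eq)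

∑-++ : ∀ (xs ys : List A) {f} → ∑ (xs ++ ys) f ≡ ∑ xs f + ∑ ys f
∑-++ []       ys     = sym (ℚ.+-identityˡ _)
∑-++ (x ∷ xs) ys {f} = trans (cong (_+_ (f x)) (∑-++ xs ys)) (sym (ℚ.+-assoc (f x) _ _))

∑-map : ∀ (h : A → B) xs {f} → ∑ (List.map h xs) f ≡ ∑ xs (f ∘ h)
∑-map h []           = refl
∑-map h (x ∷ xs) {f} = cong (_+_ (f (h x))) (∑-map h xs)

∑-concatMap : ∀ (h : A → List B) xs {f} → ∑ (concatMap h xs) f ≡ ∑ xs (λ x → ∑ (h x) f)
∑-concatMap h []       = refl
∑-concatMap h (x ∷ xs) {f} =
  trans (∑-++ (h x) (concatMap h xs)) (cong (_+_ (∑ (h x) f)) (∑-concatMap h xs))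

∑-+ : ∀ (xs : List A) {f g} → ∑ xs (λ x → f x + g x) ≡ ∑ xs f + ∑ xs g
∑-+ []               = refl
∑-+ (x ∷ xs) {f} {g} = trans (cong (_+_ (f x + g x)) (∑-+ xs))
                             (interchange (f x) (g x) (∑ xs f) (∑ xs g))
  where
  open +-*-Solver
  interchange : ∀ a b c d → (a + b) + (c + d) ≡ (a + c) + (b + d)
  interchange = solve 4 (λ a b c d → (a :+ b) :+ (c :+ d) := (a :+ c) :+ (b :+ d)) refl

∑-*ˡ : ∀ q (xs : List A) {f} → ∑ xs (λ x → q * f x) ≡ q * ∑ xs f
∑-*ˡ q []           = sym (ℚ.*-zeroʳ q)
∑-*ˡ q (x ∷ xs) {f} =
  trans (cong (_+_ (q * f x)) (∑-*ˡ q xs)) (sym (ℚ.*-distribˡ-+ q (f x) _))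

∑-const-1/ : ∀ b .{{_ : ℕ.NonZero b}} (xs : List A) →
             ∑ xs (const (+ 1 / b)) ≡ + length xs / b
∑-const-1/ b []       = /-≡ 0 1 0 b refl
∑-const-1/ b (x ∷ xs) =
  trans (cong (_+_ (+ 1 / b)) (∑-const-1/ b xs)) (1/+/ (length xs) b)

∑-const-1/length : ∀ b .{{_ : ℕ.NonZero b}} (xs : List A) → length xs ≡ b →
                   ∑ xs (const (+ 1 / b)) ≡ 1ℚ
∑-const-1/length b xs refl =
  trans (∑-const-1/ b xs) (/-≡ b b 1 1 (ℕ.*-comm b 1))

∑-upTo-suc : ∀ k {f} → ∑ (upTo (suc k)) f ≡ ∑ (upTo k) f + f k
∑-upTo-suc k {f} =
  trans (cong (λ xs → ∑ xs f) (sym (List.upTo-∷ʳ k)))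
 (trans (∑-++ (upTo k) (k ∷ []))
        (cong (_+_ (∑ (upTo k) f)) (ℚ.+-identityʳ (f k))))

map-toℕ-allFin : ∀ k → List.map toℕ (allFin k) ≡ upTo k
map-toℕ-allFin k = trans (List.map-tabulate _ toℕ) (tabulate-toℕ k (λ i → i))
  where
  tabulate-toℕ : ∀ {C : Set} k (f : ℕ → C) → List.tabulate {n = k} (f ∘ toℕ) ≡ List.applyUpTo f k
  tabulate-toℕ zero    f = refl
  tabulate-toℕ (suc k) f = cong (f 0 ∷_) (tabulate-toℕ k (f ∘ suc))

∑-allFin : ∀ k {f} → ∑ (allFin k) (f ∘ toℕ) ≡ ∑ (upTo k) f
∑-allFin k {f} = trans (sym (∑-map toℕ (allFin k))) (cong (λ xs → ∑ xs f) (map-toℕ-allFin k))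

-- Finite distributions

-- The `k`-th approximant of a real expectation is the `𝔼ℚ` of the `k`-th approximants, so exact
-- rational identities are enough.
𝔼ℚ : Dist A → (A → ℚ) → ℚ
𝔼ℚ []            f = 0ℚ
𝔼ℚ ((p , a) ∷ D) f = p * f a + 𝔼ℚ D f

record IsProbability {A : Set} (D : Dist A) : Set where
  field
    weights-nonNeg : All (λ (p , _) → 0ℚ ℚ.≤ p) D
    mass           : 𝔼ℚ D (const 1ℚ) ≡ 1ℚ

open IsProbability

𝔼ℚ-cong : ∀ (D : Dist A) {f g} → f ≗ g → 𝔼ℚ D f ≡ 𝔼ℚ D g
𝔼ℚ-cong []            eq = refl
𝔼ℚ-cong ((p , a) ∷ D) eq = cong₂ _+_ (cong (p *_) (eq a)) (𝔼ℚ-cong D eq)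

𝔼ℚ-*ˡ : ∀ q (D : Dist A) {f} → 𝔼ℚ D (λ a → q * f a) ≡ q * 𝔼ℚ D f
𝔼ℚ-*ˡ q []                = sym (ℚ.*-zeroʳ q)
𝔼ℚ-*ˡ q ((p , a) ∷ D) {f} =
  trans (cong (_+_ (p * (q * f a))) (𝔼ℚ-*ˡ q D)) (factor p q (f a) (𝔼ℚ D f))
  where
  open +-*-Solver
  factor : ∀ p q x y → p * (q * x) + q * y ≡ q * (p * x + y)
  factor = solve 4 (λ p q x y → p :* (q :* x) :+ q :* y := q :* (p :* x :+ y)) refl

𝔼ℚ-+ : ∀ (D : Dist A) {f g} → 𝔼ℚ D (λ a → f a + g a) ≡ 𝔼ℚ D f + 𝔼ℚ D g
𝔼ℚ-+ []                    = refl
𝔼ℚ-+ ((p , a) ∷ D) {f} {g} =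
  trans (cong (_+_ (p * (f a + g a))) (𝔼ℚ-+ D)) (factor p (f a) (g a) (𝔼ℚ D f) (𝔼ℚ D g))
  where
  open +-*-Solver
  factor : ∀ p x y u v → p * (x + y) + (u + v) ≡ (p * x + u) + (p * y + v)
  factor = solve 5 (λ p x y u v →
    p :* (x :+ y) :+ (u :+ v) := (p :* x :+ u) :+ (p :* y :+ v)) refl

𝔼ℚ-const : ∀ {D : Dist A} → IsProbability D → ∀ q → 𝔼ℚ D (const q) ≡ q
𝔼ℚ-const {D = D} D-prob q =
  trans (𝔼ℚ-cong D λ _ → sym (ℚ.*-identityʳ q))
 (trans (𝔼ℚ-*ˡ q D)
 (trans (cong (q *_) (mass D-prob)) (ℚ.*-identityʳ q)))

𝔼ℚ-mono : ∀ {D : Dist A} {f g} → All (λ (p , _) → 0ℚ ℚ.≤ p) D →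
          All (λ (_ , a) → f a ℚ.≤ g a) D → 𝔼ℚ D f ℚ.≤ 𝔼ℚ D g
𝔼ℚ-mono []                        []         = ℚ.≤-refl
𝔼ℚ-mono {D = (p , _) ∷ _} (0≤p ∷ 0≤ps) (le ∷ les) = ℚ.+-mono-≤
  (ℚ.*-monoˡ-≤-nonNeg p {{ℚ.nonNegative 0≤p}} le) (𝔼ℚ-mono 0≤ps les)

𝔼ℚ-map : ∀ (w : A → ℚ) (h : A → B) xs {f} →
         𝔼ℚ (List.map (λ x → w x , h x) xs) f ≡ ∑ xs (λ x → w x * f (h x))
𝔼ℚ-map w h []           = refl
𝔼ℚ-map w h (x ∷ xs) {f} = cong (_+_ (w x * f (h x))) (𝔼ℚ-map w h xs)

equidistributed : (b : ℕ) .{{_ : ℕ.NonZero b}} → List A → Dist A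
equidistributed b = List.map λ x → + 1 / b , x

𝔼ℚ-equidistributed : ∀ b .{{_ : ℕ.NonZero b}} (xs : List A) {f} →
                     𝔼ℚ (equidistributed b xs) f ≡ (+ 1 / b) * ∑ xs f
𝔼ℚ-equidistributed b xs = trans (𝔼ℚ-map _ _ xs) (∑-*ˡ (+ 1 / b) xs)

equidistributed-prob : ∀ b .{{_ : ℕ.NonZero b}} (xs : List A) → length xs ≡ b →
                       IsProbability (equidistributed b xs)
equidistributed-prob b xs eq = record
  { weights-nonNeg = All.map⁺ (All.universal (λ _ → 0≤/ 1 b) xs)
  ; mass           = trans (𝔼ℚ-map _ _ xs)
                    (trans (∑-cong xs λ _ → ℚ.*-identityʳ (+ 1 / b))
                           (∑-const-1/length b xs eq))
  }

-- Like `iid`, but each coordinate has its own law, as the signals to be simulated have one law for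
-- each time. The body copies that of `iid`, which makes `iid-⨂` an equality of lists.
⨂ : Vec (Dist A) n → Dist (Vec A n)
⨂ []       = (1ℚ , []) ∷ []
⨂ (D ∷ Ds) = concatMap (λ (p , a) → List.map (λ (q , as) → p * q , a ∷ as) (⨂ Ds)) D

iid-⨂ : ∀ (D : Dist A) m → iid D m ≡ ⨂ (replicate m D)
iid-⨂ D zero    = refl
iid-⨂ D (suc m) = cong
  (λ E → concatMap (λ (p , a) → List.map (λ (q , as) → p * q , a ∷ as) E) D) (iid-⨂ D m)

𝔼ℚ-++ : ∀ (D E : Dist A) {f} → 𝔼ℚ (D ++ E) f ≡ 𝔼ℚ D f + 𝔼ℚ E f
𝔼ℚ-++ []            E     = sym (ℚ.+-identityˡ _)
𝔼ℚ-++ ((p , a) ∷ D) E {f} =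
  trans (cong (_+_ (p * f a)) (𝔼ℚ-++ D E)) (sym (ℚ.+-assoc (p * f a) _ _))

𝔼ℚ-scale : ∀ p (h : A → B) D {f} →
           𝔼ℚ (List.map (λ (q , a) → p * q , h a) D) f ≡ p * 𝔼ℚ D (f ∘ h)
𝔼ℚ-scale p h []                = sym (ℚ.*-zeroʳ p)
𝔼ℚ-scale p h ((q , a) ∷ D) {f} =
  trans (cong (_+_ (p * q * f (h a))) (𝔼ℚ-scale p h D)) (factor p q (f (h a)) (𝔼ℚ D (f ∘ h)))
  where
  open +-*-Solver
  factor : ∀ p q x y → p * q * x + p * y ≡ p * (q * x + y)
  factor = solve 4 (λ p q x y → p :* q :* x :+ p :* y := p :* (q :* x :+ y)) refl

𝔼ℚ-⨂-∷ : ∀ (D : Dist A) (Ds : Vec (Dist A) n) {f} →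
         𝔼ℚ (⨂ (D ∷ Ds)) f ≡ 𝔼ℚ D (λ a → 𝔼ℚ (⨂ Ds) (λ as → f (a ∷ as)))
𝔼ℚ-⨂-∷ []            Ds = refl
𝔼ℚ-⨂-∷ ((p , a) ∷ D) Ds = trans
  (𝔼ℚ-++ (List.map (λ (q , as) → p * q , a ∷ as) (⨂ Ds)) (⨂ (D ∷ Ds)))
  (cong₂ _+_ (𝔼ℚ-scale p (a ∷_) (⨂ Ds)) (𝔼ℚ-⨂-∷ D Ds))

0≤* : ∀ {p q} → 0ℚ ℚ.≤ p → 0ℚ ℚ.≤ q → 0ℚ ℚ.≤ p * q
0≤* {p} {q} 0≤p 0≤q = subst (ℚ._≤ p * q) (ℚ.*-zeroʳ p)
  (ℚ.*-monoˡ-≤-nonNeg p {{ℚ.nonNegative 0≤p}} 0≤q)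

⨂-prob : ∀ (Ds : Vec (Dist A) n) → (∀ i → IsProbability (lookup Ds i)) → IsProbability (⨂ Ds)
⨂-prob [] _ = record { weights-nonNeg = ℚ.nonNegative⁻¹ 1ℚ ∷ [] ; mass = refl }
⨂-prob (D ∷ Ds) prob = record
  { weights-nonNeg = All.concat⁺ (All.map⁺ (All.map
      (λ 0≤p → All.map⁺ (All.map (0≤* 0≤p) (weights-nonNeg tail-prob)))
      (weights-nonNeg (prob zero))))
  ; mass = trans (𝔼ℚ-⨂-∷ D Ds)
          (trans (𝔼ℚ-cong D λ _ → mass tail-prob) (mass (prob zero)))
  }
  where
  tail-prob : IsProbability (⨂ Ds)
  tail-prob = ⨂-prob Ds (prob ∘ suc)

-- The other coordinates integrate to one. This allows a policy to prepare many draws and to use a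
-- single one.
𝔼ℚ-⨂-lookup : ∀ (Ds : Vec (Dist A) n) → (∀ i → IsProbability (lookup Ds i)) →
              ∀ i {f} → 𝔼ℚ (⨂ Ds) (λ as → f (lookup as i)) ≡ 𝔼ℚ (lookup Ds i) f
𝔼ℚ-⨂-lookup (D ∷ Ds) prob zero {f} =
  trans (𝔼ℚ-⨂-∷ D Ds) (𝔼ℚ-cong D λ a → 𝔼ℚ-const (⨂-prob Ds (prob ∘ suc)) (f a))
𝔼ℚ-⨂-lookup (D ∷ Ds) prob (suc i) =
  trans (𝔼ℚ-⨂-∷ D Ds)
 (trans (𝔼ℚ-cong D λ _ → 𝔼ℚ-⨂-lookup Ds (prob ∘ suc) i) (𝔼ℚ-const (prob zero) _))

-- The law of the largest signal

-- Entries are naturals and not elements of `Fin k`, so that cubes of all sides, and the shells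
-- between them, live in one type.
box : ℕ → (m : ℕ) → List (Vec ℕ m)
box k zero    = [] ∷ []
box k (suc m) = concatMap (λ j → List.map (j ∷_) (box k m)) (upTo k)

-- The vectors whose largest entry is s: either the first entry is s, or it is
-- smaller and the largest entry of the tail is s.
shell : ℕ → (m : ℕ) → List (Vec ℕ m)
shell s zero    = []
shell s (suc m) = List.map (s ∷_) (box (suc s) m) ++
                  concatMap (λ j → List.map (j ∷_) (shell s m)) (upTo s)

∑-box-suc : ∀ k m {g} → ∑ (box k (suc m)) g ≡ ∑ (upTo k) (λ j → ∑ (box k m) (g ∘ (j ∷_)))
∑-box-suc k m = trans (∑-concatMap _ (upTo k)) (∑-cong (upTo k) λ j → ∑-map (j ∷_) (box k m))

-- The two sides enumerate the same vectors in different orders, hence an equality of sums and not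
-- of lists. Split on whether the first entry is `s`; if it is smaller, the induction hypothesis
-- splits the tail.
∑-box-shell : ∀ s m {g} → ∑ (box (suc s) m) g ≡ ∑ (box s m) g + ∑ (shell s m) g
∑-box-shell s zero    = sym (ℚ.+-identityʳ _)
∑-box-shell s (suc m) {g} = begin
  ∑ (box (suc s) (suc m)) g
    ≡⟨ ∑-box-suc (suc s) m ⟩
  ∑ (upTo (suc s)) (λ j → ∑ (box (suc s) m) (g ∘ (j ∷_)))
    ≡⟨ ∑-upTo-suc s ⟩
  ∑ (upTo s) (λ j → ∑ (box (suc s) m) (g ∘ (j ∷_))) + new
    ≡⟨ cong (_+ new) (∑-cong (upTo s) λ j → ∑-box-shell s m) ⟩
  ∑ (upTo s) (λ j → ∑ (box s m) (g ∘ (j ∷_)) + ∑ (shell s m) (g ∘ (j ∷_))) + new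
    ≡⟨ cong (_+ new) (∑-+ (upTo s)) ⟩
  (old + mixed) + new
    ≡⟨ ℚ.+-assoc old mixed new ⟩
  old + (mixed + new)
    ≡⟨ cong (_+_ old) (ℚ.+-comm mixed new) ⟩
  old + (new + mixed)
    ≡⟨ cong₂ _+_ (∑-box-suc s m) ∑-shell-suc ⟨
  ∑ (box s (suc m)) g + ∑ (shell s (suc m)) g ∎
  where
  open ≡-Reasoning
  new old mixed : ℚ
  new   = ∑ (box (suc s) m) (g ∘ (s ∷_))
  old   = ∑ (upTo s) (λ j → ∑ (box s m) (g ∘ (j ∷_)))
  mixed = ∑ (upTo s) (λ j → ∑ (shell s m) (g ∘ (j ∷_)))

  ∑-shell-suc : ∑ (shell s (suc m)) g ≡ new + mixed
  ∑-shell-suc = trans (∑-++ (List.map (s ∷_) (box (suc s) m)) _)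
    (cong₂ _+_ (∑-map (s ∷_) (box (suc s) m))
               (trans (∑-concatMap _ (upTo s)) (∑-cong (upTo s) λ j → ∑-map (j ∷_) (shell s m))))

-- Peels shells off down to the cube of side 0. That cube is empty only for vectors of positive
-- length, hence `suc m`.
∑-box-shells : ∀ k m {g} →
               ∑ (box k (suc m)) g ≡ ∑ (upTo k) (λ s → ∑ (shell s (suc m)) g)
∑-box-shells zero    m = refl
∑-box-shells (suc k) m {g} = trans (∑-box-shell k (suc m))
  (trans (cong (_+ ∑ (shell k (suc m)) g) (∑-box-shells k m)) (sym (∑-upTo-suc k)))

length-prepend : ∀ {m} (js : List ℕ) (xs : List (Vec ℕ m)) →
                 length (concatMap (λ j → List.map (j ∷_) xs) js) ≡ length js ℕ.* length xs
length-prepend []       xs = refl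
length-prepend (j ∷ js) xs = trans (List.length-++ (List.map (j ∷_) xs))
  (cong₂ ℕ._+_ (List.length-map (j ∷_) xs) (length-prepend js xs))

length-box : ∀ k m → length (box k m) ≡ k ℕ.^ m
length-box k zero    = refl
length-box k (suc m) = trans (length-prepend (upTo k) (box k m))
  (cong₂ ℕ._*_ (List.length-upTo k) (length-box k m))

-- Written exactly as the numerator in `power`, so that the two weights agree by computation.
shellSize : ℕ → ℕ → ℕ
shellSize s m = suc s ℕ.^ m ℕ.∸ s ℕ.^ m

length-shell : ∀ s m → length (shell s m) ≡ shellSize s m
length-shell s m = trans (sym (ℕ.m+n∸n≡m (length (shell s m)) (s ℕ.^ m)))
                         (cong (ℕ._∸ s ℕ.^ m) (go m))
  where
  open ≡-Reasoning
  -- The additive form keeps truncated subtraction out of the induction.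
  go : ∀ m → length (shell s m) ℕ.+ s ℕ.^ m ≡ suc s ℕ.^ m
  go zero    = refl
  go (suc m) = begin
    length (shell s (suc m)) ℕ.+ s ℕ.^ suc m
      ≡⟨ cong (ℕ._+ s ℕ.^ suc m) (trans (List.length-++ (List.map (s ∷_) (box (suc s) m)))
           (cong₂ ℕ._+_ (trans (List.length-map (s ∷_) (box (suc s) m)) (length-box (suc s) m))
                        (trans (length-prepend (upTo s) (shell s m))
                               (cong (ℕ._* length (shell s m)) (List.length-upTo s))))) ⟩
    suc s ℕ.^ m ℕ.+ s ℕ.* length (shell s m) ℕ.+ s ℕ.* s ℕ.^ m
      ≡⟨ ℕ.+-assoc (suc s ℕ.^ m) _ _ ⟩
    suc s ℕ.^ m ℕ.+ (s ℕ.* length (shell s m) ℕ.+ s ℕ.* s ℕ.^ m)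
      ≡⟨ cong (suc s ℕ.^ m ℕ.+_) (ℕ.*-distribˡ-+ s (length (shell s m)) (s ℕ.^ m)) ⟨
    suc s ℕ.^ m ℕ.+ s ℕ.* (length (shell s m) ℕ.+ s ℕ.^ m)
      ≡⟨ cong (λ l → suc s ℕ.^ m ℕ.+ s ℕ.* l) (go m) ⟩
    suc s ℕ.^ suc m ∎

shellSize-nonZero : ∀ s m → ℕ.NonZero (shellSize s (suc m))
shellSize-nonZero s m = ℕ.>-nonZero (ℕ.m<n⇒0<n∸m (ℕ.^-monoˡ-< (suc m) (ℕ.n<1+n s)))

shellDist : ∀ m → ℕ → Dist (Vec ℕ (suc m))
shellDist m s = equidistributed (shellSize s (suc m)) {{shellSize-nonZero s m}} (shell s (suc m))

shellDist-prob : ∀ m s → IsProbability (shellDist m s)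
shellDist-prob m s = equidistributed-prob (shellSize s (suc m)) {{shellSize-nonZero s m}}
  (shell s (suc m)) (length-shell s (suc m))

𝔼ℚ-iid-suc : ∀ (D : Dist A) m {f} →
             𝔼ℚ (iid D (suc m)) f ≡ 𝔼ℚ D (λ a → 𝔼ℚ (iid D m) (λ as → f (a ∷ as)))
𝔼ℚ-iid-suc D m {f} rewrite iid-⨂ D m = 𝔼ℚ-⨂-∷ D (replicate m D)

𝔼ℚ-iid-uniform : ∀ k .{{_ : ℕ.NonZero k}} m {g : Vec ℕ m → ℚ} →
  𝔼ℚ (iid (uniform k) m) (g ∘ Vec.map toℕ) ≡ _/_ (+ 1) (k ℕ.^ m) {{ℕ.m^n≢0 k m}} * ∑ (box k m) g
𝔼ℚ-iid-uniform k zero    {g} = trans (ℚ.+-identityʳ _) (cong (1ℚ *_) (sym (ℚ.+-identityʳ (g []))))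
𝔼ℚ-iid-uniform k (suc m) {g} = begin
  𝔼ℚ (iid (uniform k) (suc m)) (g ∘ Vec.map toℕ)
    ≡⟨ 𝔼ℚ-iid-suc (uniform k) m ⟩
  𝔼ℚ (uniform k) (λ i → 𝔼ℚ (iid (uniform k) m) (λ is → g (toℕ i ∷ Vec.map toℕ is)))
    ≡⟨ 𝔼ℚ-cong (uniform k) (λ i → 𝔼ℚ-iid-uniform k m) ⟩
  𝔼ℚ (uniform k) (λ i → r * ∑ (box k m) (g ∘ (toℕ i ∷_)))
    ≡⟨ 𝔼ℚ-*ˡ r (uniform k) ⟩
  r * 𝔼ℚ (uniform k) (λ i → ∑ (box k m) (g ∘ (toℕ i ∷_)))
    ≡⟨ cong (r *_) (𝔼ℚ-equidistributed k (allFin k)) ⟩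
  r * ((+ 1 / k) * ∑ (allFin k) (λ i → ∑ (box k m) (g ∘ (toℕ i ∷_))))
    ≡⟨ cong (λ x → r * ((+ 1 / k) * x)) (trans (∑-allFin k) (sym (∑-box-suc k m))) ⟩
  r * ((+ 1 / k) * ∑ (box k (suc m)) g)
    ≡⟨ ℚ.*-assoc r (+ 1 / k) (∑ (box k (suc m)) g) ⟨
  r * (+ 1 / k) * ∑ (box k (suc m)) g
    ≡⟨ cong (_* ∑ (box k (suc m)) g) (/-* 1 K 1 k 1 (k ℕ.^ suc m)
         (cong (ℕ._+ 0) (ℕ.*-comm k K))) ⟩
  (+ 1 / (k ℕ.^ suc m)) * ∑ (box k (suc m)) g ∎
  where
  open ≡-Reasoning
  K : ℕ
  K = k ℕ.^ m
  instance
    _ = ℕ.m^n≢0 k m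
    _ = ℕ.m^n≢0 k (suc m)
  r : ℚ
  r = + 1 / K

powerWeight : (m k : ℕ) .{{_ : ℕ.NonZero k}} → ℕ → ℚ
powerWeight m k s = _/_ (+ shellSize s m) (k ℕ.^ m) {{ℕ.m^n≢0 k m}}

𝔼ℚ-power : ∀ m k .{{_ : ℕ.NonZero k}} {f : ℕ → ℚ} →
           𝔼ℚ (power m k) (f ∘ toℕ) ≡ ∑ (upTo k) (λ s → powerWeight m k s * f s)
𝔼ℚ-power m k {f} = trans (𝔼ℚ-map (powerWeight m k ∘ toℕ) (λ s → s) (allFin k)) (∑-allFin k)

-- Given that the largest of suc m independent uniform variables is s, they
-- are uniform on the shell of s, whatever k is.
𝔼ℚ-disintegration : ∀ k .{{_ : ℕ.NonZero k}} m {g : Vec ℕ (suc m) → ℚ} →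
  𝔼ℚ (iid (uniform k) (suc m)) (g ∘ Vec.map toℕ) ≡
  𝔼ℚ (power (suc m) k) (λ s → 𝔼ℚ (shellDist m (toℕ s)) g)
𝔼ℚ-disintegration k m {g} = begin
  𝔼ℚ (iid (uniform k) (suc m)) (g ∘ Vec.map toℕ)
    ≡⟨ 𝔼ℚ-iid-uniform k (suc m) ⟩
  r * ∑ (box k (suc m)) g
    ≡⟨ cong (r *_) (∑-box-shells k m) ⟩
  r * ∑ (upTo k) (λ s → ∑ (shell s (suc m)) g)
    ≡⟨ ∑-*ˡ r (upTo k) ⟨
  ∑ (upTo k) (λ s → r * ∑ (shell s (suc m)) g)
    ≡⟨ ∑-cong (upTo k) reweigh ⟩
  ∑ (upTo k) (λ s → powerWeight (suc m) k s * 𝔼ℚ (shellDist m s) g)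
    ≡⟨ 𝔼ℚ-power (suc m) k ⟨
  𝔼ℚ (power (suc m) k) (λ s → 𝔼ℚ (shellDist m (toℕ s)) g) ∎
  where
  open ≡-Reasoning
  instance _ = ℕ.m^n≢0 k (suc m)
  r : ℚ
  r = + 1 / (k ℕ.^ suc m)

  -- The mass 1/K of one vector is N/K, the power weight of its shell, times 1/N, the uniform mass
  -- on the shell. Only the first factor depends on `k`.
  reweigh : ∀ s → r * ∑ (shell s (suc m)) g ≡ powerWeight (suc m) k s * 𝔼ℚ (shellDist m s) g
  reweigh s = begin
    r * S                                        ≡⟨ cong (_* S) (/-* N K 1 N 1 K cross) ⟨
    powerWeight (suc m) k s * (+ 1 / N) * S      ≡⟨ ℚ.*-assoc (powerWeight (suc m) k s) (+ 1 / N) S ⟩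
    powerWeight (suc m) k s * ((+ 1 / N) * S)    ≡⟨ cong (powerWeight (suc m) k s *_)
                                                      (𝔼ℚ-equidistributed N (shell s (suc m))) ⟨
    powerWeight (suc m) k s * 𝔼ℚ (shellDist m s) g ∎
    where
    N K : ℕ
    N = shellSize s (suc m)
    K = k ℕ.^ suc m
    instance _ = shellSize-nonZero s m
    S : ℚ
    S = ∑ (shell s (suc m)) g
    cross : N ℕ.* 1 ℕ.* K ≡ 1 ℕ.* (K ℕ.* N)
    cross = trans (cong (ℕ._* K) (ℕ.*-identityʳ N)) (trans (ℕ.*-comm N K) (sym (ℕ.*-identityˡ (K ℕ.* N))))

iid-uniform-prob : ∀ k .{{_ : ℕ.NonZero k}} m → IsProbability (iid (uniform k) m)
iid-uniform-prob k m = subst IsProbability (sym (iid-⨂ (uniform k) m))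
  (⨂-prob (replicate m (uniform k)) λ i →
    subst IsProbability (sym (Vec.lookup-replicate i (uniform k)))
      (equidistributed-prob k (allFin k) (List.length-tabulate _)))

power-prob : ∀ m k .{{_ : ℕ.NonZero k}} → IsProbability (power (suc m) k)
power-prob m k = record
  { weights-nonNeg = All.map⁺ (All.universal
      (λ s → 0≤/ (shellSize (toℕ s) (suc m)) (k ℕ.^ suc m) {{ℕ.m^n≢0 k (suc m)}}) (allFin k))
  -- Disintegrating the constant 1 shows that the power weights have the same total mass as the law
  -- of the signals.
  ; mass = trans (𝔼ℚ-cong (power (suc m) k) λ s → sym (mass (shellDist-prob m (toℕ s))))
          (trans (sym (𝔼ℚ-disintegration k m)) (mass (iid-uniform-prob k (suc m))))
  }

-- The prepared draws: coordinate s is a sample of all signals, conditioned on the last one being at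
-- time s.
shells : ∀ m n → Vec (Dist (Vec ℕ (suc m))) n
shells m n = Vec.tabulate (shellDist m ∘ toℕ)

shells-lookup : ∀ m (i : Fin n) → lookup (shells m n) i ≡ shellDist m (toℕ i)
shells-lookup m i = Vec.lookup∘tabulate (shellDist m ∘ toℕ) i

shells-prob : ∀ m n (i : Fin n) → IsProbability (lookup (shells m n) i)
shells-prob m n i = subst IsProbability (sym (shells-lookup m i)) (shellDist-prob m (toℕ i))

-- Real numbers

Eventually : (ℕ → Set) → Set
Eventually P = ∃[ N ] (∀ k → N ℕ.≤ k → P k)

eventually-map₂ : ∀ {P Q R : ℕ → Set} → (∀ {k} → P k → Q k → R k) →
                  Eventually P → Eventually Q → Eventually R
eventually-map₂ f (N , p) (M , q) = N ℕ.⊔ M , λ k N⊔M≤k →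
  f (p k (ℕ.m⊔n≤o⇒m≤o N M N⊔M≤k)) (q k (ℕ.m⊔n≤o⇒n≤o N M N⊔M≤k))

eventually-map : ∀ {P Q : ℕ → Set} → (∀ {k} → P k → Q k) → Eventually P → Eventually Q
eventually-map f (N , p) = N , λ k N≤k → f (p k N≤k)

-- A finite list has a common threshold. This is why comparisons and limits pass through
-- expectations.
eventually-All : ∀ {P : A → ℕ → Set} {xs} → All (λ x → Eventually (P x)) xs →
                 Eventually (λ k → All (λ x → P x k) xs)
eventually-All []       = 0 , λ _ _ → []
eventually-All (p ∷ ps) = eventually-map₂ _∷_ p (eventually-All ps)

pointwise⇒≤ᵣ : ∀ {x y} → (∀ k → seq x k ≡ seq y k) → x ≤ᵣ y
pointwise⇒≤ᵣ {x} {y} eq ε 0<ε = 0 , λ k _ → begin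
  seq x k       ≡⟨ eq k ⟩
  seq y k       ≡⟨ ℚ.+-identityʳ (seq y k) ⟨
  seq y k + 0ℚ  ≤⟨ ℚ.+-monoʳ-≤ (seq y k) (ℚ.<⇒≤ 0<ε) ⟩
  seq y k + ε   ∎
  where open ℚ.≤-Reasoning

0<½* : ∀ {ε} → 0ℚ ℚ.< ε → 0ℚ ℚ.< ½ * ε
0<½* {ε} 0<ε = subst (ℚ._< ½ * ε) (ℚ.*-zeroʳ ½) (ℚ.*-monoʳ-<-pos ½ 0<ε)

≤ᵣ-trans : ∀ {x y z} → x ≤ᵣ y → y ≤ᵣ z → x ≤ᵣ z
≤ᵣ-trans {x} {y} {z} x≤y y≤z ε 0<ε = eventually-map₂
  (λ {k} p q → begin
    seq x k                      ≤⟨ p ⟩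
    seq y k + ½ * ε              ≤⟨ ℚ.+-monoˡ-≤ (½ * ε) q ⟩
    seq z k + ½ * ε + ½ * ε      ≡⟨ halves (seq z k) ⟩
    seq z k + ε                  ∎)
  (x≤y (½ * ε) (0<½* 0<ε)) (y≤z (½ * ε) (0<½* 0<ε))
  where
  open ℚ.≤-Reasoning
  halves : ∀ z → z + ½ * ε + ½ * ε ≡ z + ε
  halves z = trans (ℚ.+-assoc z (½ * ε) (½ * ε)) (cong (_+_ z)
    (trans (sym (ℚ.*-distribʳ-+ ε ½ ½)) (ℚ.*-identityˡ ε)))

∣-∣≤⇒≤+ : ∀ {p q ε} → ∣ p - q ∣ ℚ.≤ ε → p ℚ.≤ q + ε
∣-∣≤⇒≤+ {p} {q} {ε} le = begin
  p               ≡⟨ rearrange p q ⟩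
  q + (p - q)     ≤⟨ ℚ.+-monoʳ-≤ q (p≤∣p∣ (p - q)) ⟩
  q + ∣ p - q ∣   ≤⟨ ℚ.+-monoʳ-≤ q le ⟩
  q + ε           ∎
  where
  open ℚ.≤-Reasoning
  open +-*-Solver
  rearrange : ∀ p q → p ≡ q + (p - q)
  rearrange = solve 2 (λ p q → p := q :+ (p :- q)) refl
  p≤∣p∣ : ∀ p → p ℚ.≤ ∣ p ∣
  p≤∣p∣ p with ℚ.≤-total 0ℚ p
  ... | inj₁ 0≤p = ℚ.≤-reflexive (sym (ℚ.0≤p⇒∣p∣≡p 0≤p))
  ... | inj₂ p≤0 = ℚ.≤-trans p≤0 (ℚ.0≤∣p∣ p)

neg-minus : ∀ p q → ℚ.- (p - q) ≡ q - p
neg-minus = solve 2 (λ p q → :- (p :- q) := q :- p) refl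
  where open +-*-Solver

minus-≤ : ∀ {p q ε} → p ℚ.≤ q + ε → p - q ℚ.≤ ε
minus-≤ {p} {q} {ε} le = subst (p - q ℚ.≤_) (cancel q ε) (ℚ.+-monoˡ-≤ (ℚ.- q) le)
  where
  open +-*-Solver
  cancel : ∀ q ε → q + ε - q ≡ ε
  cancel = solve 2 (λ q ε → q :+ ε :- q := ε) refl

≤+⇒∣-∣≤ : ∀ {p q ε} → p ℚ.≤ q + ε → q ℚ.≤ p + ε → ∣ p - q ∣ ℚ.≤ ε
≤+⇒∣-∣≤ {p} {q} {ε} p≤q+ε q≤p+ε with ℚ.∣p∣≡p∨∣p∣≡-p (p - q)
... | inj₁ eq = subst (ℚ._≤ ε) (sym eq) (minus-≤ p≤q+ε)
... | inj₂ eq = subst (ℚ._≤ ε) (sym (trans eq (neg-minus p q))) (minus-≤ q≤p+ε)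

≈ᵣ-sym : ∀ {x y} → x ≈ᵣ y → y ≈ᵣ x
≈ᵣ-sym {x} {y} x≈y ε 0<ε = eventually-map (λ {k} → subst (ℚ._≤ ε) (swap (seq x k) (seq y k)))
                                          (x≈y ε 0<ε)
  where
  swap : ∀ p q → ∣ p - q ∣ ≡ ∣ q - p ∣
  swap p q = trans (sym (ℚ.∣-p∣≡∣p∣ (p - q))) (cong ∣_∣ (neg-minus p q))

≈ᵣ⇒≤ᵣ : ∀ {x y} → x ≈ᵣ y → x ≤ᵣ y
≈ᵣ⇒≤ᵣ x≈y ε 0<ε = eventually-map ∣-∣≤⇒≤+ (x≈y ε 0<ε)

≤ᵣ-antisym : ∀ {x y} → x ≤ᵣ y → y ≤ᵣ x → x ≈ᵣ y
≤ᵣ-antisym x≤y y≤x ε 0<ε = eventually-map₂ ≤+⇒∣-∣≤ (x≤y ε 0<ε) (y≤x ε 0<ε)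

pointwise⇒≈ᵣ : ∀ {x y} → (∀ k → seq x k ≡ seq y k) → x ≈ᵣ y
pointwise⇒≈ᵣ {x} {y} eq =
  ≤ᵣ-antisym {x} {y} (pointwise⇒≤ᵣ {x} {y} eq) (pointwise⇒≤ᵣ {y} {x} (sym ∘ eq))

≈ᵣ-trans : ∀ {x y z} → x ≈ᵣ y → y ≈ᵣ z → x ≈ᵣ z
≈ᵣ-trans {x} {y} {z} x≈y y≈z = ≤ᵣ-antisym {x} {z}
  (≤ᵣ-trans {x} {y} {z} (≈ᵣ⇒≤ᵣ {x} {y} x≈y) (≈ᵣ⇒≤ᵣ {y} {z} y≈z))
  (≤ᵣ-trans {z} {y} {x} (≈ᵣ⇒≤ᵣ {z} {y} (≈ᵣ-sym {y} {z} y≈z)) (≈ᵣ⇒≤ᵣ {y} {x} (≈ᵣ-sym {x} {y} x≈y)))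

cut-resp-≈ᵣ : ∀ {x y} → x ≈ᵣ y → ∀ {q} → cut x q → cut y q
cut-resp-≈ᵣ {x} {y} x≈y (r , q<r , r≤x) =
  r , q<r , ≤ᵣ-trans {fromℚ r} {x} {y} r≤x (≈ᵣ⇒≤ᵣ {x} {y} x≈y)

-- Expectations of real-valued functions

-- Opaque, because comparing two unfolded expectations would also compare the
-- proofs that their sequences are Cauchy.
opaque
  𝔼ᵣ : Dist A → (A → ℝ) → ℝ
  𝔼ᵣ = 𝔼

  seq-𝔼ᵣ : ∀ (D : Dist A) f k → seq (𝔼ᵣ D f) k ≡ 𝔼ℚ D (λ a → seq (f a) k)
  seq-𝔼ᵣ []            f k = refl
  seq-𝔼ᵣ ((p , a) ∷ D) f k = cong (_+_ (p * seq (f a) k)) (seq-𝔼ᵣ D f k)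

seq-𝔼-mapᴰ : ∀ (h : A → B) D f k → seq (𝔼 (mapᴰ h D) f) k ≡ 𝔼ℚ D (λ a → seq (f (h a)) k)
seq-𝔼-mapᴰ h []            f k = refl
seq-𝔼-mapᴰ h ((p , a) ∷ D) f k = cong (_+_ (p * seq (f (h a)) k)) (seq-𝔼-mapᴰ h D f k)

module _ {D : Dist A} (D-prob : IsProbability D) where

  -- The comparison is asked only at outcomes in the list, because facts such as `shell-max` hold
  -- only there. An error of `ε` at each outcome averages to `ε`, since the total mass is one.
  𝔼ᵣ-monoAll : ∀ {f g} → All (λ (_ , a) → f a ≤ᵣ g a) D → 𝔼ᵣ D f ≤ᵣ 𝔼ᵣ D g
  𝔼ᵣ-monoAll {f} {g} f≤g ε 0<ε = eventually-map
    (λ {k} le → begin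
      seq (𝔼ᵣ D f) k                      ≡⟨ seq-𝔼ᵣ D f k ⟩
      𝔼ℚ D (λ a → seq (f a) k)           ≤⟨ 𝔼ℚ-mono (weights-nonNeg D-prob) le ⟩
      𝔼ℚ D (λ a → seq (g a) k + ε)       ≡⟨ 𝔼ℚ-+ D ⟩
      𝔼ℚ D (λ a → seq (g a) k) + 𝔼ℚ D (const ε)
        ≡⟨ cong₂ _+_ (sym (seq-𝔼ᵣ D g k)) (𝔼ℚ-const D-prob ε) ⟩
      seq (𝔼ᵣ D g) k + ε                  ∎)
    (eventually-All (All.map (λ le → le ε 0<ε) f≤g))
    where open ℚ.≤-Reasoning

  𝔼ᵣ-mono : ∀ {f g} → (∀ a → f a ≤ᵣ g a) → 𝔼ᵣ D f ≤ᵣ 𝔼ᵣ D g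
  𝔼ᵣ-mono {f} {g} f≤g = 𝔼ᵣ-monoAll {f} {g} (All.universal (λ (_ , a) → f≤g a) D)

  𝔼ᵣ-congAll : ∀ {f g} → All (λ (_ , a) → f a ≈ᵣ g a) D → 𝔼ᵣ D f ≈ᵣ 𝔼ᵣ D g
  𝔼ᵣ-congAll {f} {g} f≈g = ≤ᵣ-antisym {𝔼ᵣ D f} {𝔼ᵣ D g}
    (𝔼ᵣ-monoAll {f} {g} (All.map (λ {(_ , a)} → ≈ᵣ⇒≤ᵣ {f a} {g a}) f≈g))
    (𝔼ᵣ-monoAll {g} {f} (All.map (λ {(_ , a)} eq → ≈ᵣ⇒≤ᵣ {g a} {f a} (≈ᵣ-sym {f a} {g a} eq)) f≈g))

  𝔼ᵣ-cong : ∀ {f g} → (∀ a → f a ≈ᵣ g a) → 𝔼ᵣ D f ≈ᵣ 𝔼ᵣ D g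
  𝔼ᵣ-cong {f} {g} f≈g = 𝔼ᵣ-congAll {f} {g} (All.universal (λ (_ , a) → f≈g a) D)

  𝔼ᵣ-const : ∀ x → 𝔼ᵣ D (const x) ≈ᵣ x
  𝔼ᵣ-const x = pointwise⇒≈ᵣ {𝔼ᵣ D (const x)} {x} λ k →
    trans (seq-𝔼ᵣ D (const x) k) (𝔼ℚ-const D-prob (seq x k))

  𝔼ᵣ-+ᵣ : ∀ f ε k → seq (𝔼ᵣ D (λ a → f a +ᵣ fromℚ ε)) k ≡ seq (𝔼ᵣ D f +ᵣ fromℚ ε) k
  𝔼ᵣ-+ᵣ f ε k = trans (seq-𝔼ᵣ D (λ a → f a +ᵣ fromℚ ε) k)
    (trans (𝔼ℚ-+ D) (cong₂ _+_ (sym (seq-𝔼ᵣ D f k)) (𝔼ℚ-const D-prob ε)))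

  𝔼ᵣ-⟶ : ∀ {x : A → ℕ → ℝ} {L : A → ℝ} → (∀ a → x a ⟶ L a) →
         (λ N → 𝔼ᵣ D (λ a → x a N)) ⟶ 𝔼ᵣ D L
  𝔼ᵣ-⟶ {x} {L} x⟶L ε 0<ε = eventually-map
    (λ {N} bounds →
        ≤ᵣ-trans {X N} {𝔼ᵣ D (λ a → L a +ᵣ fromℚ ε)} {𝔼ᵣ D L +ᵣ fromℚ ε}
          (𝔼ᵣ-monoAll {λ a → x a N} {λ a → L a +ᵣ fromℚ ε} (All.map proj₁ bounds))
          (pointwise⇒≤ᵣ {𝔼ᵣ D (λ a → L a +ᵣ fromℚ ε)} {𝔼ᵣ D L +ᵣ fromℚ ε} (𝔼ᵣ-+ᵣ L ε))
      , ≤ᵣ-trans {𝔼ᵣ D L} {𝔼ᵣ D (λ a → x a N +ᵣ fromℚ ε)} {X N +ᵣ fromℚ ε}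
          (𝔼ᵣ-monoAll {L} {λ a → x a N +ᵣ fromℚ ε} (All.map proj₂ bounds))
          (pointwise⇒≤ᵣ {𝔼ᵣ D (λ a → x a N +ᵣ fromℚ ε)} {X N +ᵣ fromℚ ε} (𝔼ᵣ-+ᵣ (λ a → x a N) ε)))
    (eventually-All (All.universal (λ (_ , a) → x⟶L a ε 0<ε) D))
    where
    X : ℕ → ℝ
    X N = 𝔼ᵣ D (λ a → x a N)

  𝔼ℚ-partialSum : ∀ (x : A → ℕ → ℝ) N k →
    𝔼ℚ D (λ a → seq (partialSum (x a) N) k) ≡ seq (partialSum (λ j → 𝔼ᵣ D (λ a → x a j)) N) k
  𝔼ℚ-partialSum x zero    k = 𝔼ℚ-const D-prob 0ℚ
  𝔼ℚ-partialSum x (suc N) k = begin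
    𝔼ℚ D (λ a → seq (partialSum (x a) N) k + seq (x a N) k)
      ≡⟨ 𝔼ℚ-+ D ⟩
    𝔼ℚ D (λ a → seq (partialSum (x a) N) k) + 𝔼ℚ D (λ a → seq (x a N) k)
      ≡⟨ cong₂ _+_ (𝔼ℚ-partialSum x N k) (sym (seq-𝔼ᵣ D (λ a → x a N) k)) ⟩
    seq (partialSum (λ j → 𝔼ᵣ D (λ a → x a j)) (suc N)) k ∎
    where open ≡-Reasoning

⟶-resp-pointwise : ∀ {x y : ℕ → ℝ} {L} → (∀ N k → seq (x N) k ≡ seq (y N) k) → x ⟶ L → y ⟶ L
⟶-resp-pointwise {x} {y} {L} eq x⟶L ε 0<ε = eventually-map
  (λ {N} (x≤ , ≤x) →
      ≤ᵣ-trans {y N} {x N} {L +ᵣ fromℚ ε} (pointwise⇒≤ᵣ {y N} {x N} (sym ∘ eq N)) x≤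
    , ≤ᵣ-trans {L} {x N +ᵣ fromℚ ε} {y N +ᵣ fromℚ ε} ≤x
        (pointwise⇒≤ᵣ {x N +ᵣ fromℚ ε} {y N +ᵣ fromℚ ε} (λ k → cong (_+ ε) (eq N k))))
  (x⟶L ε 0<ε)

-- Product of a probability space with an independent finite coin

module WithCoin (S : ProbabilitySpace) {D : Dist C} (D-prob : IsProbability D) where
  open ProbabilitySpace S

  -- Measurability is required section by section: the coin is discrete, and the product measure is
  -- a finite average of the measures of sections.
  Measurable′ : (Ω × C → Bool) → Set
  Measurable′ E = ∀ c → Measurable (λ ω → E (ω , c))

  section : (E : Ω × C → Bool) → Measurable′ E → C → ℝ
  section E e c = ℙ (λ ω → E (ω , c)) (e c)

  full′ : Measurable′ (const true)
  full′ _ = full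

  ℙ′ : (E : Ω × C → Bool) → Measurable′ E → ℝ
  ℙ′ E e = 𝔼ᵣ D (section E e)

  ℙ′-cong : ∀ {E F} (e : Measurable′ E) (f : Measurable′ F) → E ≗ F → ℙ′ E e ≈ᵣ ℙ′ F f
  ℙ′-cong {E} {F} e f E≗F = 𝔼ᵣ-cong D-prob {section E e} {section F f}
    (λ c → ℙ-cong (e c) (f c) (λ ω → E≗F (ω , c)))

  ℙ′-sections : ∀ {E g} (e : Measurable′ E) → (∀ c → section E e c ≈ᵣ g c) → ℙ′ E e ≈ᵣ 𝔼ᵣ D g
  ℙ′-sections {E} {g} e = 𝔼ᵣ-cong D-prob {section E e} {g}

  ℙ′-nonNeg : ∀ {E} (e : Measurable′ E) → fromℚ 0ℚ ≤ᵣ ℙ′ E e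
  ℙ′-nonNeg {E} e = ≤ᵣ-trans {fromℚ 0ℚ} {𝔼ᵣ D (const (fromℚ 0ℚ))} {ℙ′ E e}
    (pointwise⇒≤ᵣ {fromℚ 0ℚ} {𝔼ᵣ D (const (fromℚ 0ℚ))} λ k → sym
      (trans (seq-𝔼ᵣ D (const (fromℚ 0ℚ)) k) (𝔼ℚ-const D-prob 0ℚ)))
    (𝔼ᵣ-mono D-prob {const (fromℚ 0ℚ)} {section E e} (λ c → ℙ-nonNeg (e c)))

  ℙ′-full≈ℙ-full : ℙ′ (const true) full′ ≈ᵣ ℙ (const true) full
  ℙ′-full≈ℙ-full = pointwise⇒≈ᵣ {ℙ′ (const true) full′} {ℙ (const true) full} λ k →
    trans (seq-𝔼ᵣ D (section (const true) full′) k)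
          (𝔼ℚ-const D-prob (seq (ℙ (const true) full) k))

  ℙ′-full : ℙ′ (const true) full′ ≈ᵣ fromℚ 1ℚ
  ℙ′-full = ≈ᵣ-trans {ℙ′ (const true) full′} {ℙ (const true) full} {fromℚ 1ℚ} ℙ′-full≈ℙ-full ℙ-full

  -- Sections of a disjoint union are disjoint unions, so each section has a convergent series;
  -- finite averaging commutes with partial sums and with limits.
  ℙ′-additive : ∀ {E F} (e : ∀ k → Measurable′ (E k)) (f : Measurable′ F) →
                PairwiseDisjoint E → IsUnion F E →
                partialSum (λ k → ℙ′ (E k) (e k)) ⟶ ℙ′ F f
  ℙ′-additive {E} {F} e f disjoint F=∪E = ⟶-resp-pointwise
    {λ N → 𝔼ᵣ D (λ c → partialSum (λ k → section (E k) (e k) c) N)}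
    {partialSum (λ k → ℙ′ (E k) (e k))} {ℙ′ F f}
    (λ N k → trans (seq-𝔼ᵣ D (λ c → partialSum (λ j → section (E j) (e j) c) N) k)
                   (𝔼ℚ-partialSum D-prob (λ c j → section (E j) (e j) c) N k))
    (𝔼ᵣ-⟶ D-prob {λ c → partialSum (λ k → section (E k) (e k) c)} {section F f}
      (λ c → ℙ-additive (λ k → e k c) (f c)
        (λ j≢k ω → disjoint j≢k (ω , c)) (λ ω → F=∪E (ω , c))))

  withCoin : ProbabilitySpace
  withCoin = record
    { Ω          = Ω × C
    ; Measurable = Measurable′
    ; full       = full′
    ; complement = λ e c → complement (e c)
    ; union      = λ e F=∪E c → union (λ k → e k c) (λ ω → F=∪E (ω , c))
    ; ℙ          = ℙ′
    ; ℙ-cong     = λ {E} {F} → ℙ′-cong {E} {F}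
    ; ℙ-nonNeg   = λ {E} → ℙ′-nonNeg {E}
    ; ℙ-full     = ℙ′-full
    ; ℙ-additive = λ {E} {F} → ℙ′-additive {E} {F}
    }

-- Stopping times

firstAt-cong : ∀ {d d′ : Fin n → Bool} i → (∀ t → toℕ t ≤ toℕ i → d t ≡ d′ t) →
               firstAt d i ≡ firstAt d′ i
firstAt-cong zero    eq = eq zero z≤n
firstAt-cong (suc i) eq =
  cong₂ (λ a b → not a ∧ b) (eq zero z≤n) (firstAt-cong i λ t t≤i → eq (suc t) (s≤s t≤i))

firstAt-false : (i : Fin n) → firstAt (const false) i ≡ false
firstAt-false zero    = refl
firstAt-false (suc i) = firstAt-false i

-- `firstAt d` holds at one index at most. Restricting it to `b` can only delete that index, and `i`
-- is kept.
firstAt-restrict : ∀ (b d : Fin n → Bool) i → b i ≡ true →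
                   firstAt (λ t → b t ∧ firstAt d t) i ≡ firstAt d i
firstAt-restrict b d zero    bi rewrite bi = refl
firstAt-restrict b d (suc i) bi with d zero
... | true  = begin
  not (b zero ∧ true) ∧ firstAt (λ t → b (suc t) ∧ false) i
    ≡⟨ cong (not (b zero ∧ true) ∧_) (firstAt-cong i λ t _ → Bool.∧-zeroʳ (b (suc t))) ⟩
  not (b zero ∧ true) ∧ firstAt (const false) i
    ≡⟨ cong (not (b zero ∧ true) ∧_) (firstAt-false i) ⟩
  not (b zero ∧ true) ∧ false
    ≡⟨ Bool.∧-zeroʳ _ ⟩
  false ∎
  where open ≡-Reasoning
... | false rewrite Bool.∧-zeroʳ (b zero) = firstAt-restrict (b ∘ suc) (d ∘ suc) i bi

-- Recognising the last signal

module _ {P : Pred A 0ℓ} (P? : Decidable P) where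

  count-none : ∀ {xs : Vec A m} → VecAll.All (¬_ ∘ P) xs → count P? xs ≡ 0
  count-none                []       = refl
  count-none {xs = x ∷ xs} (¬p ∷ ¬ps) with P? x
  ... | yes p = contradiction p ¬p
  ... | no  _ = count-none ¬ps

  count-some : ∀ {xs : Vec A m} → VecAny.Any P xs → 0 < count P? xs
  count-some {xs = x ∷ xs} (here p)  with P? x
  ... | yes _ = s≤s z≤n
  ... | no ¬p = contradiction p ¬p
  count-some {xs = x ∷ xs} (there p) with P? x
  ... | yes _ = s≤s z≤n
  ... | no  _ = count-some p

count-map : ∀ {P : Pred B 0ℓ} (P? : Decidable P) (f : A → B) (xs : Vec A m) →
            count (P? ∘ f) xs ≡ count P? (Vec.map f xs)
count-map P? f []       = refl
count-map P? f (x ∷ xs) = cong (if does (P? (f x)) then suc else id) (count-map P? f xs)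

-- `after o` includes time `o` itself: it counts the signals still to come just before the
-- observation at `o`.
at after : ℕ → Vec ℕ m → ℕ
at    o = count (ℕ._≟ o)
after o = count (o ℕ.≤?_)

after-0 : (xs : Vec ℕ m) → after 0 xs ≡ m
after-0 []       = refl
after-0 (x ∷ xs) = cong suc (after-0 xs)

after-suc : ∀ o (xs : Vec ℕ m) → after o xs ≡ at o xs ℕ.+ after (suc o) xs
after-suc o []       = refl
after-suc o (x ∷ xs) = step (x ℕ.≟ o) (o ℕ.≤? x) (suc o ℕ.≤? x) (after-suc o xs)
  where
  step : ∀ {a b c} (p : Dec (x ≡ o)) (q : Dec (o ≤ x)) (r : Dec (o < x)) → a ≡ b ℕ.+ c →
         (if does q then suc else id) a ≡ (if does p then suc else id) b ℕ.+ (if does r then suc else id) c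
  step (yes x≡o) (yes _)   (yes o<x) _  = contradiction (sym x≡o) (ℕ.<⇒≢ o<x)
  step (yes _)   (yes _)   (no _)    eq = cong suc eq
  step (yes x≡o) (no o≰x)  _         _  = contradiction (ℕ.≤-reflexive (sym x≡o)) o≰x
  step {b = b} {c} (no _) (yes _) (yes _) eq = trans (cong suc eq) (sym (ℕ.+-suc b c))
  step (no x≢o)  (yes o≤x) (no o≮x)  _  = contradiction (ℕ.≤∧≢⇒< o≤x (≢-sym x≢o)) o≮x
  step (no _)    (no o≰x)  (yes o<x) _  = contradiction (ℕ.<⇒≤ o<x) o≰x
  step (no _)    (no _)    (no _)    eq = eq

IsMax : ℕ → Vec ℕ m → Set
IsMax s xs = VecAll.All (_≤ s) xs × VecAny.Any (s ≡_) xs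

box-bounded : ∀ k m → All (VecAll.All (_< k)) (box k m)
box-bounded k zero    = [] ∷ []
box-bounded k (suc m) = All.concat⁺ (All.map⁺ (All.map
  (λ j<k → All.map⁺ (All.map (j<k ∷_) (box-bounded k m)))
  (All.applyUpTo⁺₁ id k id)))

shell-max : ∀ s m → All (IsMax s) (shell s m)
shell-max s zero    = []
shell-max s (suc m) = All.++⁺
  (All.map⁺ (All.map (λ bounded → ℕ.≤-refl ∷ VecAll.map ℕ.s≤s⁻¹ bounded , here refl)
                     (box-bounded (suc s) m)))
  (All.concat⁺ (All.map⁺ (All.map
    (λ j<s → All.map⁺ (All.map (λ (≤s , s∈) → ℕ.<⇒≤ j<s ∷ ≤s , there s∈) (shell-max s m)))
    (All.applyUpTo⁺₁ id s id))))

-- r signals are still to come and c of them arrive now.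
isLast : ℕ → ℕ → Bool
isLast r c = does (1 ℕ.≤? r) ∧ does (r ℕ.≤? c)

-- Before `s`, fewer signals arrive than are outstanding. At `s`, possibly several arrive, and they
-- are all that is left. Past `s` none is outstanding, and the guard `1 ≤ r` prevents a second
-- alarm.
isLast-max : ∀ {s} {xs : Vec ℕ m} → IsMax s xs → ∀ o →
             isLast (after o xs) (at o xs) ≡ does (s ℕ.≟ o)
isLast-max {s = s} {xs} (xs≤s , s∈xs) o with ℕ.<-cmp s o
... | tri< s<o s≢o _
  rewrite count-none (o ℕ.≤?_) (VecAll.map (λ x≤s o≤x → ℕ.<⇒≱ s<o (ℕ.≤-trans o≤x x≤s)) xs≤s)
        = sym (dec-false (s ℕ.≟ o) s≢o)
... | tri≈ _ refl _ = trans
  (cong₂ _∧_ (dec-true (1 ℕ.≤? after s xs) (count-some (s ℕ.≤?_) (VecAny.map ℕ.≤-reflexive s∈xs)))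
             (dec-true (after s xs ℕ.≤? at s xs) (ℕ.≤-reflexive (trans (after-suc s xs)
               (trans (cong (at s xs ℕ.+_) none-later) (ℕ.+-identityʳ (at s xs)))))))
  (sym (dec-true (s ℕ.≟ s) refl))
  where
  none-later : after (suc s) xs ≡ 0
  none-later = count-none (suc s ℕ.≤?_) (VecAll.map (λ x≤s s<x → ℕ.<⇒≱ s<x x≤s) xs≤s)
... | tri> _ s≢o o<s = trans
  (cong (does (1 ℕ.≤? after o xs) ∧_) (dec-false (after o xs ℕ.≤? at o xs) (ℕ.<⇒≱ at<after)))
  (trans (Bool.∧-zeroʳ _) (sym (dec-false (s ℕ.≟ o) s≢o)))
  where
  at<after : at o xs < after o xs
  at<after = subst (at o xs <_) (sym (after-suc o xs))
    (ℕ.m<m+n (at o xs) (count-some (suc o ℕ.≤?_) (VecAny.map (λ { refl → o<s }) s∈xs)))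

recognise : ℕ → Vec (ℕ × ℕ) k → Vec (ℕ × Bool) k
recognise r []            = []
recognise r ((v , c) ∷ h) = (v , isLast r c) ∷ recognise (r ∸ c) h

-- Generalised to histories that begin at time `o`, with the invariant that the counter equals
-- `after o xs`.
recognise-max : ∀ {s} {xs : Vec ℕ m} → IsMax s xs → ∀ o (v : Fin k → ℕ) (c : Fin k → ℕ) →
  (∀ j → c j ≡ at (o ℕ.+ toℕ j) xs) →
  recognise (after o xs) (tabulate λ j → v j , c j) ≡
  tabulate λ j → v j , does (s ℕ.≟ o ℕ.+ toℕ j)
recognise-max {k = zero}  max o v c c≡ = refl
recognise-max {k = suc k} {s} {xs} max o v c c≡ = cong₂ _∷_
  (cong (v zero ,_) (begin
    isLast (after o xs) (c zero)  ≡⟨ cong (isLast (after o xs)) c₀ ⟩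
    isLast (after o xs) (at o xs) ≡⟨ isLast-max max o ⟩
    does (s ℕ.≟ o)                ≡⟨ cong (λ j → does (s ℕ.≟ j)) (ℕ.+-identityʳ o) ⟨
    does (s ℕ.≟ o ℕ.+ 0)          ∎))
  (begin
    recognise (after o xs ∸ c zero) rest  ≡⟨ cong (λ r → recognise r rest) later ⟩
    recognise (after (suc o) xs) rest
      ≡⟨ recognise-max max (suc o) (v ∘ suc) (c ∘ suc)
           (λ j → trans (c≡ (suc j)) (cong (λ t → at t xs) (ℕ.+-suc o (toℕ j)))) ⟩
    tabulate (λ j → v (suc j) , does (s ℕ.≟ suc o ℕ.+ toℕ j))
      ≡⟨ Vec.tabulate-cong (λ j →
           cong (λ t → v (suc j) , does (s ℕ.≟ t)) (ℕ.+-suc o (toℕ j))) ⟨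
    tabulate (λ j → v (suc j) , does (s ℕ.≟ o ℕ.+ suc (toℕ j))) ∎)
  where
  open ≡-Reasoning
  rest : Vec (ℕ × ℕ) k
  rest = tabulate λ j → v (suc j) , c (suc j)
  c₀ : c zero ≡ at o xs
  c₀ = trans (c≡ zero) (cong (λ t → at t xs) (ℕ.+-identityʳ o))
  later : after o xs ∸ c zero ≡ after (suc o) xs
  later = trans (cong₂ _∸_ (after-suc o xs) c₀) (ℕ.m+n∸m≡n (at o xs) _)

lastSignal : ℕ → Fin n → Bool
lastSignal s t = does (s ℕ.≟ toℕ t)

signalCounts : Vec ℕ m → Fin n → ℕ
signalCounts xs t = at (toℕ t) xs

recognise-history : ∀ {s} {xs : Vec ℕ m} → IsMax s xs → ∀ (v : Vec ℕ n) t →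
  recognise m (history v (signalCounts xs) t) ≡ history v (lastSignal s) t
recognise-history {m = m} {s = s} {xs} max v t = begin
  recognise m (history v (signalCounts xs) t)
    -- At time 0 all `m` signals are outstanding: here the policy uses its knowledge of `m`.
    ≡⟨ cong (λ r → recognise r (history v (signalCounts xs) t)) (after-0 xs) ⟨
  recognise (after 0 xs) (history v (signalCounts xs) t)
    ≡⟨ recognise-max max 0 (λ j → lookup v (inject≤ j (toℕ<n t))) (λ j → at (toℕ (inject≤ j (toℕ<n t))) xs)
         (λ j → cong (λ u → at u xs) (toℕ-inject≤ j (toℕ<n t))) ⟩
  tabulate (λ j → lookup v (inject≤ j (toℕ<n t)) , does (s ℕ.≟ toℕ j))
    ≡⟨ Vec.tabulate-cong (λ j →
         cong (λ u → lookup v (inject≤ j (toℕ<n t)) , does (s ℕ.≟ u)) (toℕ-inject≤ j (toℕ<n t))) ⟨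
  history v (lastSignal s) t ∎
  where open ≡-Reasoning

-- Simulating the earlier signals

-- History and prepared draws are traversed in step, so the draw returned sits at the time of the
-- signal. The result is `nothing` as long as no signal has been seen.
reveal : Vec (ℕ × Bool) k → Vec A n → Maybe A
reveal ((_ , true)  ∷ h) (x ∷ c) = just x
reveal ((_ , false) ∷ h) (x ∷ c) = reveal h c
reveal _                 _       = nothing

reveal-just : ∀ (c : Vec A n) (s : Fin n) (v : Fin k → ℕ) → toℕ s < k →
              reveal (tabulate λ j → v j , lastSignal (toℕ s) j) c ≡ just (lookup c s)
reveal-just (x ∷ c) zero    v (s≤s _)   = refl
reveal-just (x ∷ c) (suc s) v (s≤s s<k) = reveal-just c s (v ∘ suc) s<k

reveal-nothing : ∀ (c : Vec A n) (s : Fin n) (v : Fin k → ℕ) → k ≤ toℕ s →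
                 reveal (tabulate λ j → v j , lastSignal (toℕ s) j) c ≡ nothing
reveal-nothing {k = zero}  c       s       v k≤s       = refl
reveal-nothing {k = suc k} (x ∷ c) (suc s) v (s≤s k≤s) = reveal-nothing c s (v ∘ suc) k≤s

-- Equals 0 beyond the end of the history.
valueAt : Vec (ℕ × B) k → ℕ → ℕ
valueAt []            j       = 0
valueAt ((v , _) ∷ h) zero    = v
valueAt (_       ∷ h) (suc j) = valueAt h j

valueAt-tabulate : ∀ (f : Fin k → ℕ × B) j → valueAt (tabulate f) (toℕ j) ≡ proj₁ (f j)
valueAt-tabulate f zero    = refl
valueAt-tabulate f (suc j) = valueAt-tabulate (f ∘ suc) j

-- Allows past decisions of the full policy to be replayed once the signal is known. A time `u`
-- beyond the end of `h` gives junk values, but `firstAt` at the current time never looks that far.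
simulate : Vec ℕ m → Vec (ℕ × Bool) k → (u : Fin n) → History ℕ u
simulate xs h u = tabulate λ j → valueAt h (toℕ j) , at (toℕ j) xs

history-lastSignal : ∀ s (v : Vec ℕ n) t →
  history v (lastSignal s) t ≡ tabulate (λ j → lookup v (inject≤ j (toℕ<n t)) , lastSignal s j)
history-lastSignal s v t = Vec.tabulate-cong λ j →
  cong (λ u → lookup v (inject≤ j (toℕ<n t)) , does (s ℕ.≟ u)) (toℕ-inject≤ j (toℕ<n t))

simulate-history : ∀ (xs : Vec ℕ m) (v : Vec ℕ n) (obs : Fin n → Bool) {u t : Fin n} → toℕ u ≤ toℕ t →
                   simulate xs (history v obs t) u ≡ history v (signalCounts xs) u
simulate-history xs v obs {u} {t} u≤t = Vec.tabulate-cong λ j → cong₂ _,_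
  (begin
    valueAt (history v obs t) (toℕ j)
      ≡⟨ cong (valueAt (history v obs t)) (toℕ-inject≤ j (s≤s u≤t)) ⟨
    valueAt (history v obs t) (toℕ (inject≤ j (s≤s u≤t)))
      ≡⟨ valueAt-tabulate (λ l → lookup v (inject≤ l (toℕ<n t)) , obs (inject≤ l (toℕ<n t)))
                          (inject≤ j (s≤s u≤t)) ⟩
    lookup v (inject≤ (inject≤ j (s≤s u≤t)) (toℕ<n t))
      ≡⟨ cong (lookup v) (toℕ-injective (trans (toℕ-inject≤ (inject≤ j (s≤s u≤t)) (toℕ<n t))
           (trans (toℕ-inject≤ j (s≤s u≤t)) (sym (toℕ-inject≤ j (toℕ<n u)))))) ⟩
    lookup v (inject≤ j (toℕ<n u)) ∎)
  (cong (λ i → at i xs) (sym (toℕ-inject≤ j (toℕ<n u))))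
  where open ≡-Reasoning

-- The simulated policy waits for the signal, and then stops where the full
-- policy would have stopped; its success event is the same because stopping
-- before the last signal always fails.
simulatedStop : ((t : Fin n) → History ℕ t → Bool) → Vec (Vec ℕ m) n → (t : Fin n) → History Bool t → Bool
simulatedStop stop c t h = maybe′ (λ xs → firstAt (λ u → stop u (simulate xs h u)) t) false (reveal h c)

simulatedStop-success : ∀ (stop : (t : Fin n) → History ℕ t → Bool) (c : Vec (Vec ℕ m) n)
  (v : Vec ℕ n) {s i : Fin n} → toℕ s ≤ toℕ i →
  firstAt (λ t → simulatedStop stop c t (history v (lastSignal (toℕ s)) t)) i ≡
  firstAt (λ t → stop t (history v (signalCounts (lookup c s)) t)) i
simulatedStop-success stop c v {s} {i} s≤i = begin
  firstAt (λ t → simulatedStop stop c t (history v (lastSignal (toℕ s)) t)) i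
    ≡⟨ firstAt-cong i (λ t _ → decision t (toℕ s ℕ.≤? toℕ t)) ⟩
  firstAt (λ t → does (toℕ s ℕ.≤? toℕ t) ∧ firstAt d t) i
    -- The signal comes no later than the best item, so waiting for it cannot skip `i`.
    ≡⟨ firstAt-restrict (λ t → does (toℕ s ℕ.≤? toℕ t)) d i (dec-true (toℕ s ℕ.≤? toℕ i) s≤i) ⟩
  firstAt d i ∎
  where
  open ≡-Reasoning
  d : Fin _ → Bool
  d t = stop t (history v (signalCounts (lookup c s)) t)

  decision : ∀ t (s≤t? : Dec (toℕ s ≤ toℕ t)) →
    simulatedStop stop c t (history v (lastSignal (toℕ s)) t) ≡ does s≤t? ∧ firstAt d t
  decision t (yes s≤t) = trans
    (cong (maybe′ _ false) (trans (cong (λ h → reveal h c) (history-lastSignal (toℕ s) v t))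
                                  (reveal-just c s (λ j → lookup v (inject≤ j (toℕ<n t))) (s≤s s≤t))))
    (firstAt-cong t λ u u≤t → cong (stop u) (simulate-history (lookup c s) v (lastSignal (toℕ s)) u≤t))
  decision t (no s≰t) = cong (maybe′ _ false)
    (trans (cong (λ h → reveal h c) (history-lastSignal (toℕ s) v t))
           (reveal-nothing c s (λ j → lookup v (inject≤ j (toℕ<n t))) (ℕ.≰⇒> s≰t)))

-- Coupling the two models

module _ (π : Policy O n) where
  open Policy π

  successEvent : Vec ℕ n → (Fin n → O) → Fin n → Ω → Bool
  successEvent v obs i ω = firstAt (λ t → stop? ω t (history v obs t)) i

  successEvent-measurable : ∀ v obs i → Measurable (successEvent v obs i)
  successEvent-measurable v obs i = firstAt-measurable space
    (λ ω t → stop? ω t (history v obs t)) (λ t → stop?-measurable t (history v obs t)) i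

  conditionalSuccess-cong : ∀ I {obs obs′ : Fin n → O} → obs ≗ obs′ →
                            conditionalSuccess π I obs ≈ᵣ conditionalSuccess π I obs′
  conditionalSuccess-cong I {obs} {obs′} eq = ℙ-cong
    (successEvent-measurable value obs i⋆) (successEvent-measurable value obs′ i⋆)
    λ ω → firstAt-cong i⋆ λ t _ → cong (stop? ω t)
      (Vec.tabulate-cong λ j → cong (lookup value (inject≤ j (toℕ<n t)) ,_) (eq (inject≤ j (toℕ<n t))))
    where open Instance I

success-law : ∀ (M : SignalModel n) π I (D : Dist A) (h : A → Fin n → SignalModel.Obs M) →
              SignalModel.law M (Instance.i⋆ I) ≡ mapᴰ h D →
              success M π I ≈ᵣ 𝔼ᵣ D (λ a → conditionalSuccess π I (h a))
success-law M π I D h eq =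
  pointwise⇒≈ᵣ {success M π I} {𝔼ᵣ D (λ a → conditionalSuccess π I (h a))} λ k →
    trans (cong (λ L → seq (𝔼 L (conditionalSuccess π I)) k) eq)
   (trans (seq-𝔼-mapᴰ h D (conditionalSuccess π I) k)
          (sym (seq-𝔼ᵣ D (λ a → conditionalSuccess π I (h a)) k)))

𝔼ᵣ-disintegration : ∀ k .{{_ : ℕ.NonZero k}} m (f : Vec (Fin k) (suc m) → ℝ) (g : Vec ℕ (suc m) → ℝ) →
  (∀ ss → f ss ≈ᵣ g (Vec.map toℕ ss)) →
  𝔼ᵣ (iid (uniform k) (suc m)) f ≈ᵣ 𝔼ᵣ (power (suc m) k) (λ s → 𝔼ᵣ (shellDist m (toℕ s)) g)
𝔼ᵣ-disintegration k m f g f≈g = ≈ᵣ-trans {𝔼ᵣ D f} {𝔼ᵣ D g′} {R}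
  (𝔼ᵣ-cong (iid-uniform-prob k (suc m)) {f} {g′} f≈g)
  (pointwise⇒≈ᵣ {𝔼ᵣ D g′} {R} λ j →
    trans (seq-𝔼ᵣ D g′ j)
   (trans (𝔼ℚ-disintegration k m)
   (sym (trans (seq-𝔼ᵣ (power (suc m) k) (λ s → 𝔼ᵣ (shellDist m (toℕ s)) g) j)
               (𝔼ℚ-cong (power (suc m) k) λ s → seq-𝔼ᵣ (shellDist m (toℕ s)) g j)))))
  where
  D : Dist (Vec (Fin k) (suc m))
  D = iid (uniform k) (suc m)
  g′ : Vec (Fin k) (suc m) → ℝ
  g′ ss = g (Vec.map toℕ ss)
  R : ℝ
  R = 𝔼ᵣ (power (suc m) k) (λ s → 𝔼ᵣ (shellDist m (toℕ s)) g)

finCounts : ∀ {k m} → Vec (Fin k) m → Fin n → ℕ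
finCounts ss t = count (λ s → toℕ s ℕ.≟ toℕ t) ss

horizon : Instance n → ℕ
horizon I = suc (toℕ (Instance.i⋆ I))

singleSuccess : ℕ → (k : ℕ) .{{_ : ℕ.NonZero k}} → Policy Bool n → Instance n → ℝ
singleSuccess m k π I = 𝔼ᵣ (power m k) λ s → conditionalSuccess π I (lastSignal (toℕ s))

fullSuccess : ℕ → (k : ℕ) .{{_ : ℕ.NonZero k}} → Policy ℕ n → Instance n → ℝ
fullSuccess m k π I = 𝔼ᵣ (iid (uniform k) m) λ ss → conditionalSuccess π I (finCounts ss)

-- The middle term of both comparisons: the last signal first, then all signals given the last one.
disintegratedSuccess : ℕ → (k : ℕ) .{{_ : ℕ.NonZero k}} → Policy ℕ n → Instance n → ℝ
disintegratedSuccess m k π I = 𝔼ᵣ (power (suc m) k) λ s → 𝔼ᵣ (shellDist m (toℕ s)) λ xs →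
  conditionalSuccess π I (signalCounts xs)

fullSuccess-disintegrated : ∀ m k .{{_ : ℕ.NonZero k}} (π : Policy ℕ n) I →
  fullSuccess (suc m) k π I ≈ᵣ disintegratedSuccess m k π I
fullSuccess-disintegrated m k π I = 𝔼ᵣ-disintegration k m
  (λ ss → conditionalSuccess π I (finCounts ss)) (λ xs → conditionalSuccess π I (signalCounts xs))
  λ ss → conditionalSuccess-cong π I {finCounts ss} {signalCounts (Vec.map toℕ ss)}
    λ t → count-map (ℕ._≟ toℕ t) toℕ ss

-- Running a single-signal policy on the full history

recognising : ℕ → Policy Bool n → Policy ℕ n
recognising m π = record
  { space            = space
  ; stop?            = λ ω t h → stop? ω t (recognise m h)
  ; stop?-measurable = λ t h → stop?-measurable t (recognise m h)
  }
  where open Policy π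

-- On a whole shell the translated histories are the same, so the inner expectation is that of a
-- constant.
recognising-success : ∀ m k .{{_ : ℕ.NonZero k}} (π : Policy Bool n) I →
  fullSuccess (suc m) k (recognising (suc m) π) I ≈ᵣ singleSuccess (suc m) k π I
recognising-success {n} m k π I = ≈ᵣ-trans
  {fullSuccess (suc m) k π̂ I} {disintegratedSuccess m k π̂ I} {singleSuccess (suc m) k π I}
  (fullSuccess-disintegrated m k π̂ I)
  (𝔼ᵣ-cong (power-prob m k)
    {λ s → 𝔼ᵣ (shellDist m (toℕ s)) (f ∘ signalCounts)} {λ s → g (lastSignal (toℕ s))}
    λ s → ≈ᵣ-trans {𝔼ᵣ (shellDist m (toℕ s)) (f ∘ signalCounts)}
                   {𝔼ᵣ (shellDist m (toℕ s)) (const (g (lastSignal (toℕ s))))}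
                   {g (lastSignal (toℕ s))}
      (𝔼ᵣ-congAll (shellDist-prob m (toℕ s)) {f ∘ signalCounts} {const (g (lastSignal (toℕ s)))}
        (All.map⁺ (All.map (λ {xs} → on-shell (toℕ s) xs) (shell-max (toℕ s) (suc m)))))
      (𝔼ᵣ-const (shellDist-prob m (toℕ s)) (g (lastSignal (toℕ s)))))
  where
  open Instance I
  open Policy π
  π̂ : Policy ℕ n
  π̂ = recognising (suc m) π
  f : (Fin n → ℕ) → ℝ
  f = conditionalSuccess π̂ I
  g : (Fin n → Bool) → ℝ
  g = conditionalSuccess π I

  on-shell : ∀ s (xs : Vec ℕ (suc m)) → IsMax s xs → f (signalCounts xs) ≈ᵣ g (lastSignal s)
  on-shell s xs max = ℙ-cong
    (successEvent-measurable π̂ value (signalCounts xs) i⋆)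
    (successEvent-measurable π value (lastSignal s) i⋆)
    λ ω → firstAt-cong i⋆ λ t _ → cong (stop? ω t) (recognise-history max value t)

-- Running a full-history policy on a single signal

module _ (m : ℕ) (π : Policy ℕ n) where
  open Policy π
  open WithCoin space (⨂-prob (shells m n) (shells-prob m n))

  -- With draws and history fixed, the outcome of `reveal` does not vary with `ω`: the event is
  -- either a first stopping event of `π` or empty.
  simulatedStop-measurable : ∀ (c : Vec (Vec ℕ (suc m)) n) t h →
    Measurable (λ ω → simulatedStop (stop? ω) c t h)
  simulatedStop-measurable c t h with reveal h c
  ... | just xs = firstAt-measurable space (λ ω u → stop? ω u (simulate xs h u))
                    (λ u → stop?-measurable u (simulate xs h u)) t
  ... | nothing = complement full

  simulating : Policy Bool n
  simulating = record
    { space            = withCoin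
    ; stop?            = λ (ω , c) → simulatedStop (stop? ω) c
    ; stop?-measurable = λ t h c → simulatedStop-measurable c t h
    }

  -- For fixed draws the success event is that of `π` facing the vector at coordinate `s`; averaging
  -- over the draws leaves the marginal law there.
  simulating-conditional : ∀ I (s : Fin n) → toℕ s ≤ toℕ (Instance.i⋆ I) →
    conditionalSuccess simulating I (lastSignal (toℕ s)) ≈ᵣ
    𝔼ᵣ (shellDist m (toℕ s)) (λ xs → conditionalSuccess π I (signalCounts xs))
  simulating-conditional I s s≤i⋆ = ≈ᵣ-trans
    {conditionalSuccess simulating I (lastSignal (toℕ s))}
    {𝔼ᵣ (⨂ (shells m n)) (λ c → f (lookup c s))} {𝔼ᵣ (shellDist m (toℕ s)) f}
    (ℙ′-sections {E = successEvent simulating value (lastSignal (toℕ s)) i⋆}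
      {g = λ c → f (lookup c s)}
      (successEvent-measurable simulating value (lastSignal (toℕ s)) i⋆)
      λ c → ℙ-cong (successEvent-measurable simulating value (lastSignal (toℕ s)) i⋆ c)
        (successEvent-measurable π value (signalCounts (lookup c s)) i⋆)
        λ ω → simulatedStop-success (stop? ω) c value s≤i⋆)
    (pointwise⇒≈ᵣ {𝔼ᵣ (⨂ (shells m n)) (λ c → f (lookup c s))} {𝔼ᵣ (shellDist m (toℕ s)) f} λ k →
      trans (seq-𝔼ᵣ (⨂ (shells m n)) (λ c → f (lookup c s)) k)
     (trans (𝔼ℚ-⨂-lookup (shells m n) (shells-prob m n) s {λ xs → seq (f xs) k})
     (trans (cong (λ D → 𝔼ℚ D (λ xs → seq (f xs) k)) (shells-lookup m s))
            (sym (seq-𝔼ᵣ (shellDist m (toℕ s)) f k)))))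
    where
    open Instance I
    f : Vec ℕ (suc m) → ℝ
    f xs = conditionalSuccess π I (signalCounts xs)

  simulating-success : ∀ I k .{{_ : ℕ.NonZero k}} → k ≤ suc (toℕ (Instance.i⋆ I)) →
    singleSuccess (suc m) k simulating I ≈ᵣ fullSuccess (suc m) k π I
  simulating-success I k k≤ = ≈ᵣ-trans
    {singleSuccess (suc m) k simulating I} {disintegratedSuccess m k π I} {fullSuccess (suc m) k π I}
    (𝔼ᵣ-cong (power-prob m k) {λ s → conditionalSuccess simulating I (lastSignal (toℕ s))}
      {λ s → 𝔼ᵣ (shellDist m (toℕ s)) f} at-signal)
    (≈ᵣ-sym {fullSuccess (suc m) k π I} {disintegratedSuccess m k π I}
      (fullSuccess-disintegrated m k π I))
    where
    f : Vec ℕ (suc m) → ℝ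
    f xs = conditionalSuccess π I (signalCounts xs)

    at-signal : ∀ s → conditionalSuccess simulating I (lastSignal (toℕ s)) ≈ᵣ
                      𝔼ᵣ (shellDist m (toℕ s)) f
    -- The signal time lies in `Fin k`, but the draws are indexed by `Fin n`.
    at-signal s = subst
      (λ j → conditionalSuccess simulating I (lastSignal j) ≈ᵣ 𝔼ᵣ (shellDist m j) f)
      (toℕ-inject≤ s k≤n)
      (simulating-conditional I (inject≤ s k≤n)
        (ℕ.≤-trans (ℕ.≤-reflexive (toℕ-inject≤ s k≤n)) (ℕ.s≤s⁻¹ (ℕ.≤-trans (toℕ<n s) k≤))))
      where
      k≤n : k ≤ n
      k≤n = ℕ.≤-trans k≤ (toℕ<n (Instance.i⋆ I))

success-transfer : ∀ (M₁ M₂ : SignalModel n) π₁ π₂ I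
  (D₁ : Dist A) (h₁ : A → Fin n → SignalModel.Obs M₁)
  (D₂ : Dist B) (h₂ : B → Fin n → SignalModel.Obs M₂) →
  SignalModel.law M₁ (Instance.i⋆ I) ≡ mapᴰ h₁ D₁ →
  SignalModel.law M₂ (Instance.i⋆ I) ≡ mapᴰ h₂ D₂ →
  𝔼ᵣ D₁ (λ a → conditionalSuccess π₁ I (h₁ a)) ≈ᵣ 𝔼ᵣ D₂ (λ b → conditionalSuccess π₂ I (h₂ b)) →
  ∀ {r} → cut (success M₁ π₁ I) r → cut (success M₂ π₂ I) r
success-transfer M₁ M₂ π₁ π₂ I D₁ h₁ D₂ h₂ law₁ law₂ eq =
  cut-resp-≈ᵣ {success M₁ π₁ I} {success M₂ π₂ I}
    (≈ᵣ-trans {success M₁ π₁ I} {E₁} {success M₂ π₂ I} (success-law M₁ π₁ I D₁ h₁ law₁)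
      (≈ᵣ-trans {E₁} {E₂} {success M₂ π₂ I} eq
        (≈ᵣ-sym {success M₂ π₂ I} {E₂} (success-law M₂ π₂ I D₂ h₂ law₂))))
  where
  E₁ E₂ : ℝ
  E₁ = 𝔼ᵣ D₁ (λ a → conditionalSuccess π₁ I (h₁ a))
  E₂ = 𝔼ᵣ D₂ (λ b → conditionalSuccess π₂ I (h₂ b))

recognising-cut : ∀ m (π : Policy Bool n) I {r} → cut (success (single (suc m) n) π I) r →
                  cut (success (fullHistory (suc m) n) (recognising (suc m) π) I) r
recognising-cut {n} m π I {r} =
  success-transfer (single (suc m) n) (fullHistory (suc m) n) π (recognising (suc m) π) I
    (power (suc m) (horizon I)) (λ s → lastSignal (toℕ s))
    (iid (uniform (horizon I)) (suc m)) finCounts refl refl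
    (≈ᵣ-sym {fullSuccess (suc m) (horizon I) (recognising (suc m) π) I}
            {singleSuccess (suc m) (horizon I) π I}
      (recognising-success m (horizon I) π I))
    {r}

simulating-cut : ∀ m (π : Policy ℕ n) I {r} → cut (success (fullHistory (suc m) n) π I) r →
                 cut (success (single (suc m) n) (simulating m π) I) r
simulating-cut {n} m π I {r} =
  success-transfer (fullHistory (suc m) n) (single (suc m) n) π (simulating m π) I
    (iid (uniform (horizon I)) (suc m)) finCounts
    (power (suc m) (horizon I)) (λ s → lastSignal (toℕ s)) refl refl
    (≈ᵣ-sym {singleSuccess (suc m) (horizon I) (simulating m π) I}
            {fullSuccess (suc m) (horizon I) π I}
      (simulating-success m π I (horizon I) ℕ.≤-refl))
    {r}

theorem8 : (n m : ℕ) → 1 ≤ n → 1 ≤ m → OPT-rand n m ≋ OPT-rand-full n m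
theorem8 n (suc m) _ _ q = mk⇔
  -- Success probabilities agree on each instance, so the same rational `r` bounds both infima.
  (λ (π , r , q<r , w) → recognising (suc m) π , r , q<r , λ I → recognising-cut m π I (w I))
  (λ (π , r , q<r , w) → simulating m π , r , q<r , λ I → simulating-cut m π I (w I))
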